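{- (1) $2\mathrm{N}/\mathrm{poly}=\mathrm{co}\mbox{ - }2\mathrm{N}/\mathrm{poly}$. (2) $2\mathrm{NPD}/\mathrm{poly}=\mathrm{co}\mbox{ - }2\mathrm{NPD}/\mathrm{poly}$. Statement (2) still holds if the underlying 2npda's are required to run in polynomial time.
   Context: A promise problem over $\Sigma$ is $(A,R)$ with $A,R\subseteq\Sigma^*$, $A\cap R=\varnothing$; families are $\mathcal{L}=\{(L_n^{(+)},L_n^{(-)})\}_{n\in\mathbb{N}}$ over a common alphabet. A 2nfa is a two-way nondeterministic finite automaton (finite state set $Q$, input between endmarkers $\rhd,\lhd$, two-way read-only head); a 2npda additionally has a stack with alphabet $\Gamma$. A machine solves $(A,R)$ if every $x\in A$ has an accepting computation path and for every $x\in R$ all (halting) computation paths are rejecting. Size: $|Q|$ for 2nfa's, $|Q|\cdot|\Gamma^{\le e}|$ for 2npda's ($e$ maximal push length); polynomial size means size$(M_n)\le p(n)$ for a polynomial $p$. $2\mathrm{N}$ ($2\mathrm{NPD}$) is the class of families such that a polynomial-size family of 2nfa's (2npda's) $\{M_n\}$ has $M_n$ solving $(L_n^{(+)},L_n^{(-)})$ for all $n$; the polynomial-time version additionally requires a polynomial $p$ such that $M_n$ solves it within $p(n,|x|)$ steps. $\mathrm{co}\mbox{ - }\mathcal{C}$ is the set of families $\{(L_n^{(-)},L_n^{(+)})\}_n$ with $\{(L_n^{(+)},L_n^{(-)})\}_n\in\mathcal{C}$. $\mathcal{C}/\mathrm{poly}$ is the set of families in $\mathcal{C}$ with a polynomial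 ceiling: a polynomial $p$ with $L_n^{(+)}\cup L_n^{(-)}\subseteq\Sigma^{\le p(n)}$ for all $n$. -}

module Defs where

open import Data.Nat using (ℕ; zero; suc; _+_; _*_; _^_; _≤_; _<_)
open import Data.Fin using (Fin)
open import Data.List using (List; []; _∷_; length; _++_)
open import Data.List.Membership.Propositional using (_∈_)
open import Data.Maybe using (Maybe; just; nothing)
open import Data.Product using (Σ; ∃; _×_; _,_; proj₁; proj₂)
open import Data.Sum using (_⊎_)
open import Data.Empty using (⊥)
open import Relation.Nullary using (¬_)
open import Relation.Binary.PropositionalEquality using (_≡_)
open import Relation.Binary.Construct.Closure.ReflexiveTransitive using (Star)

data Poly (k : ℕ) : Set where
  var : Fin k → Poly k
  con : ℕ → Poly k
  _⊕_ : Poly k → Poly k → Poly k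
  _⊗_ : Poly k → Poly k → Poly k

⟦_⟧ : ∀ {k} → Poly k → (Fin k → ℕ) → ℕ
⟦ var i ⟧ ρ = ρ i
⟦ con c ⟧ ρ = c
⟦ p ⊕ q ⟧ ρ = ⟦ p ⟧ ρ + ⟦ q ⟧ ρ
⟦ p ⊗ q ⟧ ρ = ⟦ p ⟧ ρ * ⟦ q ⟧ ρ

eval₁ : Poly 1 → ℕ → ℕ
eval₁ p n = ⟦ p ⟧ (λ _ → n)

eval₂ : Poly 2 → ℕ → ℕ → ℕ
eval₂ p n m = ⟦ p ⟧ ρ
  where
  ρ : Fin 2 → ℕ
  ρ Fin.zero = n
  ρ (Fin.suc _) = m

Str : ℕ → Set
Str s = List (Fin s)

record PromiseProblem (s : ℕ) : Set₁ where
  field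
    Acc      : Str s → Set
    Rej      : Str s → Set
    disjoint : ∀ x → Acc x → Rej x → ⊥

Family : ℕ → Set₁
Family s = ℕ → PromiseProblem s

swapPP : ∀ {s} → PromiseProblem s → PromiseProblem s
swapPP P = record
  { Acc = PromiseProblem.Rej P
  ; Rej = PromiseProblem.Acc P
  ; disjoint = λ x r a → PromiseProblem.disjoint P x a r }

co : ∀ {s} → (Family s → Set) → Family s → Set
co C L = C (λ n → swapPP (L n))

HasPolyCeiling : ∀ {s} → Family s → Set
HasPolyCeiling L = Σ (Poly 1) λ p → ∀ n (x : Str _) →
  (PromiseProblem.Acc (L n) x ⊎ PromiseProblem.Rej (L n) x) → length x ≤ eval₁ p n

_/poly : ∀ {s} → (Family s → Set) → Family s → Set
(C /poly) L = C L × HasPolyCeiling L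

-- Tapes: ▷ x ◁, positions 0 .. |x|+1

data TapeSym (s : ℕ) : Set where
  ▷ : TapeSym s
  ◁ : TapeSym s
  sym : Fin s → TapeSym s

tapeAt : ∀ {s} → Str s → ℕ → TapeSym s
tapeAt x zero = ▷
tapeAt [] (suc i) = ◁
tapeAt (a ∷ x) (suc zero) = sym a
tapeAt (a ∷ x) (suc (suc i)) = tapeAt x (suc i)

data Move : Set where
  left stay right : Move

move : ℕ → Move → Maybe ℕ
move zero left = nothing
move (suc i) left = just i
move i stay = just i
move i right = just (suc i)

ValidMove : ∀ {s} → Str s → ℕ → Move → ℕ → Set
ValidMove x i m j = (move i m ≡ just j) × (j ≤ suc (length x))

record TwoNFA (s : ℕ) : Set where
  field
    nstates : ℕ
    start   : Fin nstates
    accept  : Fin nstates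
    reject  : Fin nstates
    δ       : Fin nstates → TapeSym s → List (Fin nstates × Move)

module _ {s : ℕ} (M : TwoNFA s) where
  open TwoNFA M

  NConf : Set
  NConf = Fin nstates × ℕ

  NStep : Str s → NConf → NConf → Set
  NStep x (q , i) (q' , j) =
    ¬ (q ≡ accept) × ¬ (q ≡ reject) ×
    Σ Move λ m → ((q' , m) ∈ δ q (tapeAt x i)) × ValidMove x i m j

  NAccepts : Str s → Set
  NAccepts x = Σ ℕ λ j → Star (NStep x) (start , 0) (accept , j)

  NSolves : PromiseProblem s → Set
  NSolves P = (∀ x → PromiseProblem.Acc P x → NAccepts x)
            × (∀ x → PromiseProblem.Rej P x → ¬ NAccepts x)

nfaSize : ∀ {s} → TwoNFA s → ℕ
nfaSize M = TwoNFA.nstates M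

2N : ∀ {s} → Family s → Set
2N {s} L = Σ (Poly 1) λ p → Σ (ℕ → TwoNFA s) λ M →
  ∀ n → (nfaSize (M n) ≤ eval₁ p n) × NSolves (M n) (L n)

record TwoNPDA (s : ℕ) : Set where
  field
    nstates  : ℕ
    nstack   : ℕ
    bottom   : Fin nstack
    start    : Fin nstates
    accept   : Fin nstates
    reject   : Fin nstates
    e        : ℕ
    δ        : Fin nstates → TapeSym s → Fin nstack →
               List (Fin nstates × Move × List (Fin nstack))
    pushBound : ∀ q a z q' m w → (q' , m , w) ∈ δ q a z → length w ≤ e

-- |Γ^{≤e}| = Σ_{i=0}^{e} |Γ|^i
wordsUpTo : ℕ → ℕ → ℕ
wordsUpTo g zero = 1
wordsUpTo g (suc e) = wordsUpTo g e + g ^ suc e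

pdaSize : ∀ {s} → TwoNPDA s → ℕ
pdaSize M = TwoNPDA.nstates M * wordsUpTo (TwoNPDA.nstack M) (TwoNPDA.e M)

module _ {s : ℕ} (M : TwoNPDA s) where
  open TwoNPDA M

  PConf : Set
  PConf = Fin nstates × ℕ × List (Fin nstack)

  PStep : Str s → PConf → PConf → Set
  PStep x (q , i , γ) (q' , j , γ') =
    ¬ (q ≡ accept) × ¬ (q ≡ reject) ×
    Σ (Fin nstack) λ z → Σ (List (Fin nstack)) λ rest → Σ Move λ m → Σ (List (Fin nstack)) λ w →
      (γ ≡ z ∷ rest) × ((q' , m , w) ∈ δ q (tapeAt x i) z) ×
      ValidMove x i m j × (γ' ≡ w ++ rest)

  initP : PConf
  initP = start , 0 , (bottom ∷ [])

  PAccepts : Str s → Set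
  PAccepts x = Σ ℕ λ j → Σ (List (Fin nstack)) λ γ → Star (PStep x) initP (accept , j , γ)

  PSolves : PromiseProblem s → Set
  PSolves P = (∀ x → PromiseProblem.Acc P x → PAccepts x)
            × (∀ x → PromiseProblem.Rej P x → ¬ PAccepts x)

  PStepsN : Str s → ℕ → PConf → PConf → Set
  PStepsN x zero c c' = c ≡ c'
  PStepsN x (suc k) c c' = Σ PConf λ c'' → PStep x c c'' × PStepsN x k c'' c'

  PHaltsWithin : Str s → ℕ → Set
  PHaltsWithin x t = ∀ c → ¬ PStepsN x (suc t) initP c

2NPD : ∀ {s} → Family s → Set
2NPD {s} L = Σ (Poly 1) λ p → Σ (ℕ → TwoNPDA s) λ M →
  ∀ n → (pdaSize (M n) ≤ eval₁ p n) × PSolves (M n) (L n)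

2NPD-polytime : ∀ {s} → Family s → Set
2NPD-polytime {s} L = Σ (Poly 1) λ p → Σ (Poly 2) λ t → Σ (ℕ → TwoNPDA s) λ M →
  ∀ n → (pdaSize (M n) ≤ eval₁ p n) × PSolves (M n) (L n) ×
        (∀ x → (PromiseProblem.Acc (L n) x ⊎ PromiseProblem.Rej (L n) x) →
               PHaltsWithin (M n) x (eval₂ t n (length x)))

{-# OPTIONS --safe #-}
module Submission where

open import Defs
open import Data.Nat
open import Data.Nat.Properties
open import Data.Nat.DivMod
open import Data.Nat.Divisibility using (divides-refl)
open import Data.Nat.Tactic.RingSolver using (solve-∀)
open import Data.Fin as Fin using (Fin; toℕ; combine; remQuot; inject₁)
open import Data.Fin.Properties using (toℕ-fromℕ<; remQuot-combine; toℕ<n; toℕ-injective; toℕ-inject₁)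
  renaming (_≟_ to _≟F_)
open import Data.Fin.Permutation.Components using (transpose; transpose-inverse)
open import Data.List using (List; []; _∷_; length; _++_; map; concatMap; upTo)
open import Data.List.Properties using (length-map; map-++; map-∘; map-cong; map-id; ≡-dec)
open import Data.List.Membership.Propositional using (_∈_; find; lose)
open import Data.List.Membership.Propositional.Properties
  using (∈-map⁺; ∈-map⁻; ∈-++⁺ˡ; ∈-++⁺ʳ; ∈-++⁻; ∈-concatMap⁺; ∈-concatMap⁻; ∈-upTo⁺; ∈-upTo⁻)
open import Data.List.Membership.DecPropositional using (_∈?_)
open import Data.List.Relation.Unary.Any using (here; there)
open import Data.List.Relation.Unary.All using (All; []; _∷_)
open import Data.List.Relation.Unary.All.Properties using () renaming (++⁺ to All-++⁺)
open import Data.Maybe using (Maybe; just; nothing)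
open import Data.Maybe.Properties using (just-injective)
open import Data.Product using (Σ; ∃; _×_; _,_; proj₁; proj₂)
import Data.Product.Properties as Product
open import Data.Sum using (_⊎_; inj₁; inj₂)
open import Data.Empty using (⊥-elim)
open import Data.Unit using (⊤; tt)
open import Function using (it)
open import Relation.Nullary using (¬_; Dec; yes; no)
open import Relation.Nullary.Decidable using (map′; _×-dec_; _⊎-dec_; _→-dec_; ¬?)
open import Relation.Binary.Definitions using (DecidableEquality; tri<; tri≈; tri>)
open import Relation.Binary.PropositionalEquality renaming (sym to ≡-sym)
open import Relation.Binary.Construct.Closure.ReflexiveTransitive using (Star; ε; _◅_; _◅◅_)

-- Inductive counting, one gate at a time. Acceptance by a machine on an input x is turned into the truth of
-- the last gate of an acyclic circuit of polynomial size whose rules are "gate g holds", "g if h", "g if h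
-- and k"; the rules for g depend on a single tape cell. A pushdown machine can verify a true gate by a
-- top-down proof. Knowing the number c of true gates below i, it can also certify that gate i is false: for
-- every rule of i it guesses a false premise h, and exhibits c true gates below i other than h. So it can
-- count the true gates one by one and finally certify that the last gate is false.
--
-- For 2nfa's the gates are "configuration c accepts within j steps"; no rule has two premises, so the stack is
-- never used. For 2npda's they speak of surface configurations: "started at (q , i) with stack word w, the
-- machine accepts, resp. pops w and is then at (q′ , i′)". Gates carry a level j. Bounding the depth of
-- derivations by j gives a correct but possibly slow machine, and levels up to the number of atoms suffice.
-- In the polynomial-time case j bounds the size of derivations instead, which is at most the running time;
-- proofs of true gates are then short, no balancing of derivations is needed, and a clock in the finite
-- control makes all computations halt.

-- Codes of finite types

-- The polynomial ceiling makes counting possible: the head positions of promised inputs fit into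
-- the finite control, so there are only polynomially many surface configurations, and one circuit
-- per n serves all promised inputs. The plain rules for acceptance are cyclic and offer no order in
-- which to count, since the truth of an atom may depend on atoms not yet counted. Levels break the
-- cycles: every premise of gate i lies below i, where the count is already known. The machine
-- cannot remember which gates are true, and its stack is taken by the pending goals of the current
-- proof. Hence the bookkeeping consists of a fixed number of counters in the finite control, and a
-- proof returns to it only with the stack back at its bottom. Depth-bounded proofs are unfolded as
-- trees and can take exponentially many steps. Bounding the size makes the steps linear in the
-- level, at the price of rules that also guess how a budget is divided between two premises.

clamp : ∀ b .{{_ : NonZero b}} → ℕ → Fin b
clamp b n = n mod b

toℕ-clamp : ∀ {b n} .{{_ : NonZero b}} → n < b → toℕ (clamp b n) ≡ n
toℕ-clamp {b} {n} n<b = trans (toℕ-fromℕ< (m%n<n n b)) (m<n⇒m%n≡m n<b)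

clamp-toℕ : ∀ {b} .{{_ : NonZero b}} (i : Fin b) → clamp b (toℕ i) ≡ i
clamp-toℕ i = toℕ-injective (toℕ-clamp (toℕ<n i))

-- A total encoding into Fin bound that is only required to be faithful on the valid elements.
record Code (T : Set) : Set₁ where
  field
    bound  : ℕ
    code   : T → Fin bound
    decode : Fin bound → T
    Valid  : T → Set
    decode-code : ∀ {t} → Valid t → decode (code t) ≡ t

open Code

code-injective : ∀ {T} (c : Code T) {t u} → Valid c t → Valid c u → code c t ≡ code c u → t ≡ u
code-injective c vt vu eq = trans (≡-sym (decode-code c vt)) (trans (cong (decode c) eq) (decode-code c vu))

belowCode : ∀ b .{{_ : NonZero b}} → Code ℕ
belowCode b = record
  { bound = b ; code = clamp b ; decode = toℕ ; Valid = _< b ; decode-code = toℕ-clamp }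

infixr 4 _×ᶜ_
_×ᶜ_ : ∀ {T U} → Code T → Code U → Code (T × U)
_×ᶜ_ {T} {U} c d = record
  { bound = bound c * bound d
  ; code = λ { (t , u) → combine (code c t) (code d u) }
  ; decode = λ i → let q = remQuot (bound d) i in decode c (proj₁ q) , decode d (proj₂ q)
  ; Valid = λ { (t , u) → Valid c t × Valid d u }
  ; decode-code = λ { {t , u} (vt , vu) →
      trans (cong (λ q → decode c (proj₁ q) , decode d (proj₂ q)) (remQuot-combine (code c t) (code d u)))
            (cong₂ _,_ (decode-code c vt) (decode-code d vu)) } }

codeVia : ∀ {T U} (f : T → U) (g : U → T) → (∀ t → g (f t) ≡ t) → Code U → Code T
codeVia f g gf c = record
  { bound = bound c
  ; code = λ t → code c (f t)
  ; decode = λ i → g (decode c i)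
  ; Valid = λ t → Valid c (f t)
  ; decode-code = λ {t} v → trans (cong g (decode-code c v)) (gf t) }

-- The index is an upper bound on the number of steps.
data Run {A : Set} (R : A → A → Set) : ℕ → A → A → Set where
  stop : ∀ {n a} → Run R n a a
  step : ∀ {n a b c} → R a b → Run R n b c → Run R (suc n) a c

weaken : ∀ {A R m n} {a b : A} → m ≤ n → Run R m a b → Run R n a b
weaken _ stop = stop
weaken (s≤s m≤n) (step r rs) = step r (weaken m≤n rs)

_▷▷_ : ∀ {A R m n} {a b c : A} → Run R m a b → Run R n b c → Run R (m + n) a c
stop {m} ▷▷ qs = weaken (m≤n+m _ m) qs
step r rs ▷▷ qs = step r (rs ▷▷ qs)

run⇒star : ∀ {A R n} {a b : A} → Run R n a b → Star R a b
run⇒star stop = ε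
run⇒star (step r rs) = r ◅ run⇒star rs

star⇒run : ∀ {A : Set} {R : A → A → Set} {a b : A} → Star R a b → ∃ λ n → Run R n a b
star⇒run ε = 0 , stop
star⇒run (r ◅ rs) = let n , rs′ = star⇒run rs in suc n , step r rs′

star-invariant : ∀ {A : Set} {R : A → A → Set} (P : A → Set) →
  (∀ {a b} → R a b → P a → P b) → ∀ {a b} → Star R a b → P a → P b
star-invariant P pres ε p = p
star-invariant P pres (r ◅ rs) p = star-invariant P pres rs (pres r p)

-- Circuits

data Rule (G : Set) : Set where
  none fact : Rule G
  one : G → Rule G
  two : G → G → Rule G

data Holds {G : Set} (P : G → Set) : Rule G → Set where
  fact : Holds P fact
  one  : ∀ {h} → P h → Holds P (one h)
  two  : ∀ {h k} → P h → P k → Holds P (two h k)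

data Premise {G : Set} (h : G) : Rule G → Set where
  one  : Premise h (one h)
  twoˡ : ∀ {k} → Premise h (two h k)
  twoʳ : ∀ {k} → Premise h (two k h)

holds-premise : ∀ {G P} {h : G} {ρ} → Holds P ρ → Premise h ρ → P h
holds-premise (one p) one = p
holds-premise (two p q) twoˡ = p
holds-premise (two p q) twoʳ = q

holds? : ∀ {G} {P : G → Set} ρ → (∀ {h} → Premise h ρ → Dec (P h)) → Dec (Holds P ρ)
holds? none P? = no λ ()
holds? fact P? = yes fact
holds? (one h) P? = map′ one (λ { (one p) → p }) (P? one)
holds? (two h k) P? = map′ (λ { (p , q) → two p q }) (λ { (two p q) → p , q }) (P? twoˡ ×-dec P? twoʳ)

-- The input enters only through the one symbol given to `rule`, so that one circuit serves all
-- inputs; `acyclic` accordingly ranges over every symbol.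
record Circuit (s : ℕ) : Set where
  field
    target : ℕ
    slots  : ℕ
    pos    : ℕ → ℕ
    rule   : ℕ → TapeSym s → ℕ → Rule ℕ
    acyclic : ∀ g a r {h} → Premise h (rule g a r) → h < g

module Counting {P : ℕ → Set} (P? : ∀ k → Dec (P k)) where

  tally : ∀ {A : Set} → Dec A → ℕ
  tally (yes _) = 1
  tally (no _) = 0

  count : ℕ → ℕ
  count zero = 0
  count (suc k) = tally (P? k) + count k

  count-yes : ∀ {k} → P k → count (suc k) ≡ suc (count k)
  count-yes {k} p with P? k
  ... | yes _ = refl
  ... | no ¬p = ⊥-elim (¬p p)

  count-no : ∀ {k} → ¬ P k → count (suc k) ≡ count k
  count-no {k} ¬p with P? k
  ... | yes p = ⊥-elim (¬p p)
  ... | no _ = refl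

  count-step : ∀ k → count k ≤ count (suc k)
  count-step k = m≤n+m (count k) (tally (P? k))

  count≤ : ∀ k → count k ≤ k
  count≤ zero = z≤n
  count≤ (suc k) with P? k
  ... | yes _ = s≤s (count≤ k)
  ... | no _ = m≤n⇒m≤1+n (count≤ k)

module Truth {s} (C : Circuit s) (x : Str s) where
  open Circuit C

  rule′ : ℕ → ℕ → Rule ℕ
  rule′ g = rule g (tapeAt x (pos g))

  data True : ℕ → Set where
    by : ∀ {g} r → r < slots → Holds True (rule′ g r) → True g

  private
    search : ∀ g → (∀ {h} → h < g → Dec (True h)) → Dec (True g)
    search g below = map′ (λ { (r , r< , h) → by r r< h }) (λ { (by r r< h) → r , r< , h })
      (anyUpTo? (λ r → holds? (rule′ g r) (λ p → below (acyclic g _ r p))) slots)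

    trueBelow? : ∀ n {g} → g < n → Dec (True g)
    trueBelow? (suc n) {g} g<sn = search g (λ h<g → trueBelow? n (<-≤-trans h<g (s≤s⁻¹ g<sn)))

  -- The recursion descends along `acyclic`, with the bound of `trueBelow?` as fuel. Decidability
  -- allows true gates to be counted and the guesses of an accepting run to be made by case
  -- distinction.
  true? : ∀ g → Dec (True g)
  true? g = trueBelow? (suc g) ≤-refl

  open Counting true? public

restrict : ∀ {T} (c : Code T) (P : T → Set) → (∀ {t} → P t → Valid c t) → Code T
restrict c P P⇒Valid = record
  { bound = bound c ; code = code c ; decode = decode c ; Valid = P
  ; decode-code = λ p → decode-code c (P⇒Valid p) }

-- Pushdown programs with random access to the tape

record Program (s : ℕ) : Set₁ where
  field
    State : Set
    start accept reject : State
    states : Code State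
    symbols : ℕ
    pos   : State → ℕ
    next : State → TapeSym s → ℕ → List (State × List ℕ)
    pos-accept : pos accept ≡ 0
    pos-reject : pos reject ≡ 0
    next-accept : ∀ {a z t} → ¬ (t ∈ next accept a z)
    next-reject : ∀ {a z t} → ¬ (t ∈ next reject a z)
    bottom< : 0 < symbols
    start-valid : Valid states start
    accept-valid : Valid states accept
    reject-valid : Valid states reject
    next-valid : ∀ {q a z q′ w} → Valid states q → z < symbols → (q′ , w) ∈ next q a z →
                  Valid states q′ × All (_< symbols) w
    push≤2 : ∀ {q a z q′ w} → (q′ , w) ∈ next q a z → length w ≤ 2

  Conf : Set
  Conf = State × List ℕ

  data Step (x : Str s) : Conf → Conf → Set where
    fire : ∀ {q z rest q′ w} → (q′ , w) ∈ next q (tapeAt x (pos q)) z →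
           Step x (q , z ∷ rest) (q′ , w ++ rest)

when : ∀ {P A : Set} → Dec P → List A → List A
when (yes _) xs = xs
when (no _) xs = []

∈-when⁺ : ∀ {P A : Set} {y : A} {xs} (d : Dec P) → P → y ∈ xs → y ∈ when d xs
∈-when⁺ (yes _) p y∈ = y∈
∈-when⁺ (no ¬p) p y∈ = ⊥-elim (¬p p)

∈-when⁻ : ∀ {P A : Set} {y : A} {xs} (d : Dec P) → y ∈ when d xs → P × y ∈ xs
∈-when⁻ (yes p) y∈ = p , y∈

-- The counting program

module Complementer {s} (C : Circuit s) where
  open Circuit C

  -- main i c: c of the gates below i are true, gate i is next.
  -- refute i c r: gate i is claimed false, the rules below r have been refuted.
  -- scan i c r g k d: rule r of gate i is being refuted by its premise g; d true gates other than g
  -- have been exhibited among the gates below k.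
  data Frame : Set where
    main   : (i c : ℕ) → Frame
    refute : (i c r : ℕ) → Frame
    scan   : (i c r g k d : ℕ) → Frame

  -- verify F g: prove gate g and the gates on the stack, then continue with F.
  data State : Set where
    run    : Frame → State
    verify : Frame → ℕ → State
    accept reject : State

  cell : State → ℕ
  cell (run (refute i c r)) = pos i
  cell (verify F g) = pos g
  cell _ = 0

  -- Stack symbol 0 is the bottom and `suc h` the pending goal h, so the top symbol decides between
  -- `return` and `pop`. A `fact` among the rules of a gate under refutation allows neither
  -- `skip-rule` nor `pick`: the computation is stuck.
  data Trans (a : TapeSym s) : State → ℕ → State → List ℕ → Set where
    guess-false : ∀ {i c z} → Trans a (run (main i c)) z (run (refute i c 0)) (z ∷ [])
    guess-true  : ∀ {i c z} → i < target →
                  Trans a (run (main i c)) z (verify (main (suc i) (suc c)) i) (z ∷ [])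
    skip-rule   : ∀ {i c r z} → r < slots → rule i a r ≡ none →
                  Trans a (run (refute i c r)) z (run (refute i c (suc r))) (z ∷ [])
    pick        : ∀ {i c r g z} → r < slots → Premise g (rule i a r) →
                  Trans a (run (refute i c r)) z (run (scan i c r g 0 0)) (z ∷ [])
    next-gate   : ∀ {i c z} → i < target →
                  Trans a (run (refute i c slots)) z (run (main (suc i) c)) (z ∷ [])
    finish      : ∀ {c z} → Trans a (run (refute target c slots)) z accept (z ∷ [])
    scan-skip   : ∀ {i c r g k d z} → k < i →
                  Trans a (run (scan i c r g k d)) z (run (scan i c r g (suc k) d)) (z ∷ [])
    scan-true   : ∀ {i c r g k d z} → k < i → k ≢ g →
                  Trans a (run (scan i c r g k d)) z (verify (scan i c r g (suc k) (suc d)) k) (z ∷ [])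
    scan-done   : ∀ {i c r g z} →
                  Trans a (run (scan i c r g i c)) z (run (refute i c (suc r))) (z ∷ [])
    return      : ∀ {F g r} → r < slots → rule g a r ≡ fact →
                  Trans a (verify F g) 0 (run F) (0 ∷ [])
    pop         : ∀ {F g r h} → r < slots → rule g a r ≡ fact →
                  Trans a (verify F g) (suc h) (verify F h) []
    prove-one   : ∀ {F g r h z} → r < slots → rule g a r ≡ one h →
                  Trans a (verify F g) z (verify F h) (z ∷ [])
    prove-two   : ∀ {F g r h h′ z} → r < slots → rule g a r ≡ two h h′ →
                  Trans a (verify F g) z (verify F h) (suc h′ ∷ z ∷ [])

  afterRule : (i c r : ℕ) → Rule ℕ → List State
  afterRule i c r none = run (refute i c (suc r)) ∷ []
  afterRule i c r fact = []
  afterRule i c r (one h) = run (scan i c r h 0 0) ∷ []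
  afterRule i c r (two h h′) = run (scan i c r h 0 0) ∷ run (scan i c r h′ 0 0) ∷ []

  expand : Frame → ℕ → Rule ℕ → List (State × List ℕ)
  expand F z none = []
  expand F zero fact = (run F , 0 ∷ []) ∷ []
  expand F (suc h) fact = (verify F h , []) ∷ []
  expand F z (one h) = (verify F h , z ∷ []) ∷ []
  expand F z (two h h′) = (verify F h , suc h′ ∷ z ∷ []) ∷ []

  frameNext : TapeSym s → Frame → List State
  frameNext a (main i c) =
    run (refute i c 0) ∷ when (i <? target) (verify (main (suc i) (suc c)) i ∷ [])
  frameNext a (refute i c r) =
    when (r <? slots) (afterRule i c r (rule i a r)) ++
    when (r ≟ slots) (when (i <? target) (run (main (suc i) c) ∷ []) ++ when (i ≟ target) (accept ∷ []))
  frameNext a (scan i c r g k d) =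
    when (k <? i) (run (scan i c r g (suc k) d) ∷
                   when (k ≢? g) (verify (scan i c r g (suc k) (suc d)) k ∷ [])) ++
    when (k ≟ i) (when (d ≟ c) (run (refute i c (suc r)) ∷ []))
    where
    _≢?_ : (m n : ℕ) → Dec (m ≢ n)
    m ≢? n = ¬? (m ≟ n)

  keep : ℕ → State → State × List ℕ
  keep z q = q , z ∷ []

  next : State → TapeSym s → ℕ → List (State × List ℕ)
  next (run F) a z = map (keep z) (frameNext a F)
  next (verify F g) a z = concatMap (λ r → expand F z (rule g a r)) (upTo slots)
  next accept a z = []
  next reject a z = []

  next-sound : ∀ {q a z q′ w} → (q′ , w) ∈ next q a z → Trans a q z q′ w
  next-sound {run F} {a} {z} t∈ with q , q∈ , refl ← ∈-map⁻ (keep z) t∈ = frame F q∈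
    where
    rules : ∀ {i c r q} → r < slots → q ∈ afterRule i c r (rule i a r) →
            Trans a (run (refute i c r)) z q (z ∷ [])
    rules {i} {c} {r} r< q∈ with rule i a r in eq | q∈
    ... | none    | here refl = skip-rule r< eq
    ... | one h   | here refl = pick r< (subst (Premise h) (≡-sym eq) one)
    ... | two h k | here refl = pick r< (subst (Premise h) (≡-sym eq) twoˡ)
    ... | two h k | there (here refl) = pick r< (subst (Premise k) (≡-sym eq) twoʳ)

    frame : ∀ {q} F → q ∈ frameNext a F → Trans a (run F) z q (z ∷ [])
    frame (main i c) (here refl) = guess-false
    frame (main i c) (there q∈) with i< , here refl ← ∈-when⁻ (i <? target) q∈ = guess-true i<
    frame (refute i c r) q∈ with ∈-++⁻ (when (r <? slots) (afterRule i c r (rule i a r))) q∈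
    ... | inj₁ q∈₁ = let r< , q∈₂ = ∈-when⁻ (r <? slots) q∈₁ in rules r< q∈₂
    ... | inj₂ q∈₁ with refl , q∈₂ ← ∈-when⁻ (r ≟ slots) q∈₁
      with ∈-++⁻ (when (i <? target) (run (main (suc i) c) ∷ [])) q∈₂
    ...   | inj₁ q∈₃ with i< , here refl ← ∈-when⁻ (i <? target) q∈₃ = next-gate i<
    ...   | inj₂ q∈₃ with refl , here refl ← ∈-when⁻ (i ≟ target) q∈₃ = finish
    frame (scan i c r g k d) q∈
      with ∈-++⁻ (when (k <? i) (run (scan i c r g (suc k) d) ∷ _)) q∈
    ... | inj₁ q∈₁ with ∈-when⁻ (k <? i) q∈₁
    ...   | k< , here refl = scan-skip k<
    ...   | k< , there q∈₂ with k≢ , here refl ← ∈-when⁻ (¬? (k ≟ g)) q∈₂ = scan-true k< k≢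
    frame (scan i c r g k d) q∈ | inj₂ q∈₁
      with refl , q∈₂ ← ∈-when⁻ (k ≟ i) q∈₁
      with refl , here refl ← ∈-when⁻ (d ≟ c) q∈₂ = scan-done
  next-sound {verify F g} {a} {z} t∈ =
    let r , r∈ , t∈₁ = find (∈-concatMap⁻ (λ r → expand F z (rule g a r)) {xs = upTo slots} t∈)
    in expanded z r (∈-upTo⁻ r∈) t∈₁
    where
    expanded : ∀ {q′ w} z r → r < slots → (q′ , w) ∈ expand F z (rule g a r) → Trans a (verify F g) z q′ w
    expanded z r r< t∈ with rule g a r in eq
    expanded zero r r< (here refl) | fact = return r< eq
    expanded (suc h) r r< (here refl) | fact = pop r< eq
    expanded z r r< (here refl) | one h = prove-one r< eq
    expanded z r r< (here refl) | two h h′ = prove-two r< eq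

  next-complete : ∀ {q a z q′ w} → Trans a q z q′ w → (q′ , w) ∈ next q a z
  next-complete {a = a} {z} = λ where
      guess-false → here refl
      (guess-true {i} i<) → ∈-map⁺ (keep z) (there (∈-when⁺ (i <? target) i< (here refl)))
      (skip-rule {i} {c} {r} r< eq) → inRules r< (subst (λ ρ → _ ∈ afterRule i c r ρ) (≡-sym eq) (here refl))
      (pick {i} {c} {r} r< p) → inRules r< (picked p)
      (next-gate {i} {c} i<) → atEnd (∈-++⁺ˡ (∈-when⁺ (i <? target) i< (here refl)))
      (finish {c}) → atEnd (∈-++⁺ʳ (when (target <? target) (run (main (suc target) c) ∷ []))
                                   (∈-when⁺ (target ≟ target) refl (here refl)))
      (scan-skip {i} {k = k} k<) → ∈-map⁺ (keep z) (∈-++⁺ˡ (∈-when⁺ (k <? i) k< (here refl)))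
      (scan-true {i} {g = g} {k} k< k≢) →
        ∈-map⁺ (keep z) (∈-++⁺ˡ (∈-when⁺ (k <? i) k< (there (∈-when⁺ (¬? (k ≟ g)) k≢ (here refl)))))
      (scan-done {i} {c}) →
        ∈-map⁺ (keep z) (∈-++⁺ʳ (when (i <? i) _) (∈-when⁺ (i ≟ i) refl (∈-when⁺ (c ≟ c) refl (here refl))))
      (return r< eq) → inExpand r< eq (here refl)
      (pop r< eq) → inExpand r< eq (here refl)
      (prove-one {F} r< eq) → inExpand {F} r< eq (one∈ z)
      (prove-two {F} r< eq) → inExpand {F} r< eq (two∈ z)
    where
    inRules : ∀ {i c r q} → r < slots → q ∈ afterRule i c r (rule i a r) →
              keep z q ∈ next (run (refute i c r)) a z
    inRules {r = r} r< q∈ = ∈-map⁺ (keep z) (∈-++⁺ˡ (∈-when⁺ (r <? slots) r< q∈))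

    picked : ∀ {i c r h ρ} → Premise h ρ → run (scan i c r h 0 0) ∈ afterRule i c r ρ
    picked one = here refl
    picked twoˡ = here refl
    picked twoʳ = there (here refl)

    atEnd : ∀ {i c q} → q ∈ (when (i <? target) (run (main (suc i) c) ∷ []) ++ when (i ≟ target) (accept ∷ [])) →
            keep z q ∈ next (run (refute i c slots)) a z
    atEnd {i} {c} q∈ = ∈-map⁺ (keep z)
      (∈-++⁺ʳ (when (slots <? slots) (afterRule i c slots (rule i a slots))) (∈-when⁺ (slots ≟ slots) refl q∈))

    inExpand : ∀ {F g r z ρ t} → r < slots → rule g a r ≡ ρ → t ∈ expand F z ρ → t ∈ next (verify F g) a z
    inExpand {F} {g} {r} {z} r< refl t∈ =
      ∈-concatMap⁺ (λ r → expand F z (rule g a r)) {xs = upTo slots} (lose (∈-upTo⁺ r<) t∈)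

    one∈ : ∀ {F h} z → (verify F h , z ∷ []) ∈ expand F z (one h)
    one∈ zero = here refl
    one∈ (suc _) = here refl

    two∈ : ∀ {F h h′} z → (verify F h , suc h′ ∷ z ∷ []) ∈ expand F z (two h h′)
    two∈ zero = here refl
    two∈ (suc _) = here refl

-- Coding the states of the counting program by base-β digits

module Machine {s} (C : Circuit s) (β : ℕ) .{{_ : NonZero β}}
  (target< : suc (Circuit.target C) < β) (slots< : Circuit.slots C < β) (4≤β : 4 ≤ β) where
  open Circuit C
  open Complementer C

  -- The counters are bounded by the loop variables rather than by β: `c` and `d` never grow faster
  -- than `i` and `k`, whose increments are guarded in `Trans`. A bare bound by β would not survive
  -- `suc c` or `suc d`.
  InRange : Frame → Set
  InRange (main i c) = i ≤ target × c ≤ i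
  InRange (refute i c r) = i ≤ target × c ≤ i × r ≤ slots
  InRange (scan i c r g k d) = i ≤ target × c ≤ i × r < slots × g ≤ target × k ≤ i × d ≤ k

  Ranged : State → Set
  Ranged (run F) = InRange F
  Ranged (verify F g) = InRange F × suc g < β
  Ranged accept = ⊤
  Ranged reject = ⊤

  Tuple : Set
  Tuple = ℕ × ℕ × ℕ × ℕ × ℕ × ℕ × ℕ × ℕ × ℕ

  flatFrame : Frame → ℕ × ℕ × ℕ × ℕ × ℕ × ℕ × ℕ
  flatFrame (main i c) = 0 , i , c , 0 , 0 , 0 , 0
  flatFrame (refute i c r) = 1 , i , c , r , 0 , 0 , 0
  flatFrame (scan i c r g k d) = 2 , i , c , r , g , k , d

  flat : State → Tuple
  flat (run F) = 0 , 0 , flatFrame F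
  flat (verify F g) = 1 , g , flatFrame F
  flat accept = 2 , 0 , 0 , 0 , 0 , 0 , 0 , 0 , 0
  flat reject = 3 , 0 , 0 , 0 , 0 , 0 , 0 , 0 , 0

  unflatFrame : ℕ × ℕ × ℕ × ℕ × ℕ × ℕ × ℕ → Frame
  unflatFrame (0 , i , c , _) = main i c
  unflatFrame (1 , i , c , r , _) = refute i c r
  unflatFrame (_ , i , c , r , g , k , d) = scan i c r g k d

  unflat : Tuple → State
  unflat (0 , _ , F) = run (unflatFrame F)
  unflat (1 , g , F) = verify (unflatFrame F) g
  unflat (2 , _) = accept
  unflat (_ , _) = reject

  unflat-flatFrame : ∀ F → unflatFrame (flatFrame F) ≡ F
  unflat-flatFrame (main _ _) = refl
  unflat-flatFrame (refute _ _ _) = refl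
  unflat-flatFrame (scan _ _ _ _ _ _) = refl

  unflat-flat : ∀ q → unflat (flat q) ≡ q
  unflat-flat (run F) = cong run (unflat-flatFrame F)
  unflat-flat (verify F g) = cong (λ F → verify F g) (unflat-flatFrame F)
  unflat-flat accept = refl
  unflat-flat reject = refl

  digit : Code ℕ
  digit = belowCode β

  tuples : Code Tuple
  tuples = digit ×ᶜ digit ×ᶜ digit ×ᶜ digit ×ᶜ digit ×ᶜ digit ×ᶜ digit ×ᶜ digit ×ᶜ digit

  private
    0<β : 0 < β
    0<β = ≤-trans (s≤s z≤n) 4≤β
    1<β : 1 < β
    1<β = ≤-trans (s≤s (s≤s z≤n)) 4≤β
    2<β : 2 < β
    2<β = ≤-trans (s≤s (s≤s (s≤s z≤n))) 4≤β
    gate< : ∀ {i} → i ≤ target → i < β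
    gate< i≤ = <-trans (s≤s i≤) target<

    premise< : ∀ {g a r h ρ} → suc g < β → rule g a r ≡ ρ → Premise h ρ → suc h < β
    premise< {g} {a} {r} g< refl p = <-trans (s≤s (acyclic g a r p)) g<

  ranged-frame : ∀ F → InRange F → Valid (digit ×ᶜ digit ×ᶜ digit ×ᶜ digit ×ᶜ digit ×ᶜ digit ×ᶜ digit) (flatFrame F)
  ranged-frame (main i c) (i≤ , c≤) =
    0<β , gate< i≤ , gate< (≤-trans c≤ i≤) , 0<β , 0<β , 0<β , 0<β
  ranged-frame (refute i c r) (i≤ , c≤ , r≤) =
    1<β , gate< i≤ , gate< (≤-trans c≤ i≤) , ≤-<-trans r≤ slots< , 0<β , 0<β , 0<β
  ranged-frame (scan i c r g k d) (i≤ , c≤ , r< , g≤ , k≤ , d≤) =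
    2<β , gate< i≤ , gate< (≤-trans c≤ i≤) , <-trans r< slots< , gate< g≤ , gate< (≤-trans k≤ i≤) ,
    gate< (≤-trans d≤ (≤-trans k≤ i≤))

  ranged-flat : ∀ q → Ranged q → Valid tuples (flat q)
  ranged-flat (run F) F∈ = 0<β , 0<β , ranged-frame F F∈
  ranged-flat (verify F g) (F∈ , g<) = 1<β , <-trans (n<1+n g) g< , ranged-frame F F∈
  ranged-flat accept _ = 2<β , 0<β , 0<β , 0<β , 0<β , 0<β , 0<β , 0<β , 0<β
  ranged-flat reject _ = 4≤β , 0<β , 0<β , 0<β , 0<β , 0<β , 0<β , 0<β , 0<β

  stateCode : Code State
  stateCode = restrict (codeVia flat unflat unflat-flat tuples) Ranged (λ {q} → ranged-flat q)

  Trans-ranged : ∀ {a q z q′ w} → Ranged q → z < β → Trans a q z q′ w →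
                 Ranged q′ × All (_< β) w
  Trans-ranged (i≤ , c≤) z< guess-false = (i≤ , c≤ , z≤n) , z< ∷ []
  Trans-ranged (i≤ , c≤) z< (guess-true i<) = ((i< , s≤s c≤) , ≤-<-trans i< (<-trans (n<1+n _) target<)) , z< ∷ []
  Trans-ranged (i≤ , c≤ , r≤) z< (skip-rule r< _) = (i≤ , c≤ , r<) , z< ∷ []
  Trans-ranged (i≤ , c≤ , r≤) z< (pick r< p) =
    (i≤ , c≤ , r< , ≤-trans (<⇒≤ (acyclic _ _ _ p)) i≤ , z≤n , z≤n) , z< ∷ []
  Trans-ranged (i≤ , c≤ , r≤) z< (next-gate i<) = (i< , m≤n⇒m≤1+n c≤) , z< ∷ []
  Trans-ranged _ z< finish = tt , z< ∷ []
  Trans-ranged (i≤ , c≤ , r< , g≤ , k≤ , d≤) z< (scan-skip k<) =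
    (i≤ , c≤ , r< , g≤ , k< , m≤n⇒m≤1+n d≤) , z< ∷ []
  Trans-ranged (i≤ , c≤ , r< , g≤ , k≤ , d≤) z< (scan-true k< _) =
    ((i≤ , c≤ , r< , g≤ , k< , s≤s d≤) , ≤-<-trans (≤-trans k< i≤) (<-trans (n<1+n _) target<)) , z< ∷ []
  Trans-ranged (i≤ , c≤ , r< , g≤ , k≤ , d≤) z< scan-done = (i≤ , c≤ , r<) , z< ∷ []
  Trans-ranged (F∈ , g<) z< (return _ _) = F∈ , 0<β ∷ []
  Trans-ranged (F∈ , g<) z< (pop _ _) = (F∈ , z<) , []
  Trans-ranged (F∈ , g<) z< (prove-one _ eq) = (F∈ , premise< g< eq one) , z< ∷ []
  Trans-ranged (F∈ , g<) z< (prove-two _ eq) =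
    (F∈ , premise< g< eq twoˡ) , premise< g< eq twoʳ ∷ z< ∷ []

  push-bound : ∀ {a q z q′ w} → Trans a q z q′ w → length w ≤ 2
  push-bound (prove-two _ _) = ≤-refl
  push-bound (pop _ _) = z≤n
  push-bound guess-false = s≤s z≤n
  push-bound (guess-true _) = s≤s z≤n
  push-bound (skip-rule _ _) = s≤s z≤n
  push-bound (pick _ _) = s≤s z≤n
  push-bound (next-gate _) = s≤s z≤n
  push-bound finish = s≤s z≤n
  push-bound (scan-skip _) = s≤s z≤n
  push-bound (scan-true _ _) = s≤s z≤n
  push-bound scan-done = s≤s z≤n
  push-bound (return _ _) = s≤s z≤n
  push-bound (prove-one _ _) = s≤s z≤n

  program : Program s
  program = record
    { State = State ; start = run (main 0 0) ; accept = accept ; reject = reject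
    ; states = stateCode ; symbols = β ; pos = cell ; next = next
    ; pos-accept = refl ; pos-reject = refl
    ; next-accept = λ () ; next-reject = λ ()
    ; bottom< = 0<β
    ; start-valid = z≤n , z≤n ; accept-valid = tt ; reject-valid = tt
    ; next-valid = λ {q} v z< t∈ → Trans-ranged {q = q} v z< (next-sound {q} t∈)
    ; push≤2 = λ {q} t∈ → push-bound (next-sound {q} t∈) }

  -- Soundness of counting: an accepting run refutes the target

  module Correctness (x : Str s) where
    open Truth C x
    open Program program using (Conf; Step; fire)

    -- In the `scan` case `d` counts only true gates other than `g`, so a true `g` that has been
    -- passed leaves `d` strictly behind `count k`. At `k = i` with `d = c = count i` this makes `g`
    -- false, because premises of `i` lie below `i`.
    FrameInv : Frame → Set
    FrameInv (main i c) = c ≡ count i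
    FrameInv (refute i c r) = c ≡ count i × (∀ {r′} → r′ < r → ¬ Holds True (rule′ i r′))
    FrameInv (scan i c r g k d) =
      FrameInv (refute i c r) × Premise g (rule′ i r) × d ≤ count k × (g < k → True g → d < count k)

    -- During a verification the invariant of the frame is only conditional on the truth of the
    -- current gate and of all goals on the stack. A rule replaces one of these hypotheses by its
    -- premises, and a fact met at the bottom symbol discharges the last one.
    Inv : Conf → Set
    Inv (run F , γ) = γ ≡ 0 ∷ [] × FrameInv F
    Inv (verify F g , γ) = Σ (List ℕ) λ goals →
      γ ≡ map suc goals ++ 0 ∷ [] × (True g → All True goals → FrameInv F)
    Inv (accept , γ) = ¬ True target
    Inv (reject , γ) = ⊤

    refute-next : ∀ {i c r} → FrameInv (refute i c r) → ¬ Holds True (rule′ i r) → FrameInv (refute i c (suc r))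
    refute-next {r = r} (c≡ , failed) ¬h = c≡ , λ r′< → extend (m≤n⇒m<n∨m≡n (s≤s⁻¹ r′<))
      where
      extend : ∀ {r′} → r′ < r ⊎ r′ ≡ r → ¬ Holds True (rule′ _ r′)
      extend (inj₁ r′<r) = failed r′<r
      extend (inj₂ refl) = ¬h

    all-refuted : ∀ {i} → (∀ {r} → r < slots → ¬ Holds True (rule′ i r)) → ¬ True i
    all-refuted failed (by r r< h) = failed r< h

    Trans-inv : ∀ {q z q′ w rest} → Trans (tapeAt x (cell q)) q z q′ w →
                Inv (q , z ∷ rest) → Inv (q′ , w ++ rest)
    Trans-inv guess-false (γ≡ , c≡) = γ≡ , c≡ , λ ()
    Trans-inv (guess-true _) (γ≡ , c≡) =
      [] , γ≡ , λ t _ → trans (cong suc c≡) (≡-sym (count-yes t))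
    Trans-inv (skip-rule _ eq) (γ≡ , inv) =
      γ≡ , refute-next inv (λ h → none-fails (subst (Holds True) eq h))
      where
      none-fails : ¬ Holds True none
      none-fails ()
    Trans-inv (pick r< p) (γ≡ , inv) = γ≡ , inv , p , z≤n , λ ()
    Trans-inv (next-gate _) (γ≡ , c≡ , failed) = γ≡ , trans c≡ (≡-sym (count-no (all-refuted failed)))
    Trans-inv finish (γ≡ , c≡ , failed) = all-refuted failed
    Trans-inv (scan-skip {g = g} {k} {d} k<) (γ≡ , inv , p , d≤ , d<) =
      γ≡ , inv , p , ≤-trans d≤ (count-step k) , λ g< t → exceeds t (m≤n⇒m<n∨m≡n (s≤s⁻¹ g<))
      where
      exceeds : True g → g < k ⊎ g ≡ k → d < count (suc k)
      exceeds t (inj₁ g<k) = <-≤-trans (d< g<k t) (count-step k)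
      -- Here the gap arises: skipping a true `g` raises `count` but not `d`.
      exceeds t (inj₂ refl) = subst (d <_) (≡-sym (count-yes t)) (s≤s d≤)
    Trans-inv (scan-true {g = g} {k} {d} k< k≢g) (γ≡ , inv , p , d≤ , d<) =
      [] , γ≡ , λ t _ → inv , p , subst (suc d ≤_) (≡-sym (count-yes t)) (s≤s d≤) ,
        λ g< tg → subst (suc d <_) (≡-sym (count-yes t))
                    (s≤s (d< (≤∧≢⇒< (s≤s⁻¹ g<) (λ g≡k → k≢g (≡-sym g≡k))) tg))
    Trans-inv (scan-done {i} {r = r}) (γ≡ , inv , p , d≤ , d<) =
      γ≡ , refute-next inv λ h →
        <-irrefl (proj₁ inv) (d< (acyclic i _ r p) (holds-premise h p))
    Trans-inv (return r< eq) ([] , refl , inv) =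
      refl , inv (by _ r< (subst (Holds True) (≡-sym eq) fact)) []
    Trans-inv (return r< eq) (_ ∷ _ , () , inv)
    Trans-inv (pop r< eq) (h ∷ goals , refl , inv) =
      goals , refl , λ t ts → inv (by _ r< (subst (Holds True) (≡-sym eq) fact)) (t ∷ ts)
    Trans-inv (pop r< eq) ([] , () , inv)
    Trans-inv (prove-one r< eq) (goals , γ≡ , inv) =
      goals , γ≡ , λ t ts → inv (by _ r< (subst (Holds True) (≡-sym eq) (one t))) ts
    Trans-inv (prove-two r< eq) (goals , γ≡ , inv) =
      _ ∷ goals , cong (_ ∷_) γ≡ ,
      λ { t (t′ ∷ ts) → inv (by _ r< (subst (Holds True) (≡-sym eq) (two t t′))) ts }

    step-inv : ∀ {c c′} → Step x c c′ → Inv c → Inv c′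
    step-inv (fire {q} t∈) = Trans-inv (next-sound {q} t∈)

    start-inv : Inv (run (main 0 0) , 0 ∷ [])
    start-inv = refl , refl

  -- Completeness of counting, with step bounds

  module Completeness (w : ℕ → ℕ) (W : ℕ)
    (w-bound : ∀ g → g ≤ target → w g ≤ W)
    (w-pos : ∀ g → 0 < w g)
    (w-one : ∀ {g a r h} → rule g a r ≡ one h → w h < w g)
    (w-two : ∀ {g a r h k} → rule g a r ≡ two h k → w h + w k < w g)
    (x : Str s) where
    open Truth C x
    open Program program using (Conf; Step; fire)

    continue : Frame → ℕ → List ℕ → Conf
    continue F zero γ = run F , 0 ∷ γ
    continue F (suc h) γ = verify F h , γ

    by-trans : ∀ {q z q′ w rest} → Trans (tapeAt x (cell q)) q z q′ w → Step x (q , z ∷ rest) (q′ , w ++ rest)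
    by-trans t = fire (next-complete t)

    conclude : ∀ {F g r} z γ → r < slots → rule′ g r ≡ fact → Step x (verify F g , z ∷ γ) (continue F z γ)
    conclude zero γ r< eq = by-trans (return r< eq)
    conclude (suc h) γ r< eq = by-trans (pop r< eq)

    -- A proof traverses the tree of `True` with one step per node, repeating shared subproofs;
    -- `w-one` and `w-two` pay for this. The weight is abstract because the depth-bounded and the
    -- size-bounded circuit use different ones.
    prove : ∀ {g} F z γ → True g → Run (Step x) (w g) (verify F g , z ∷ γ) (continue F z γ)
    prove {g} F z γ (by r r< h) with rule′ g r in eq | h
    ... | fact | fact = weaken (w-pos g) (step (conclude z γ r< eq) stop)
    ... | one _ | one t = weaken (w-one eq) (step (by-trans (prove-one r< eq)) (prove F z γ t))
    -- The proof of the first premise ends by popping `suc k`, which by `continue` is the start of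
    -- the proof of `k` with `z` on top again.
    ... | two _ k | two t u =
      weaken (w-two eq) (step (by-trans (prove-two r< eq)) (prove F (suc k) (z ∷ γ) t ▷▷ prove F z γ u))

    -- Each scanned gate costs one step and at most `W` for its proof. `gateTime` adds the costs of
    -- guessing true and guessing false, so it bounds either; the last summand of `totalTime` pays
    -- for the target.
    scanTime ruleTime gateTime totalTime : ℕ
    scanTime = target * suc W + 1
    ruleTime = suc scanTime
    gateTime = suc W + (slots * ruleTime + 2)
    totalTime = target * gateTime + gateTime

    bottomed : Frame → Conf
    bottomed F = run F , 0 ∷ []

    do-scan : ∀ {i r g} m k → k + m ≡ i → i ≤ target → ¬ True g →
      Run (Step x) (m * suc W + 1) (bottomed (scan i (count i) r g k (count k)))
        (bottomed (refute i (count i) (suc r)))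
    do-scan zero k eq i≤ ¬g rewrite trans (≡-sym (+-identityʳ k)) eq = step (by-trans scan-done) stop
    do-scan {i} {r} {g} (suc m) k eq i≤ ¬g = weaken (≤-reflexive (≡-sym (+-assoc (suc W) (m * suc W) 1)))
      (advance (true? k) ▷▷ do-scan m (suc k) (trans (≡-sym (+-suc k m)) eq) i≤ ¬g)
      where
      k<i : k < i
      k<i = subst (k <_) eq (m<m+n k (s≤s z≤n))
      advance : Dec (True k) → Run (Step x) (suc W) (bottomed (scan i (count i) r g k (count k)))
                                             (bottomed (scan i (count i) r g (suc k) (count (suc k))))
      advance (no ¬k) rewrite count-no ¬k = step (by-trans (scan-skip k<i)) stop
      advance (yes t) rewrite count-yes t =
        step (by-trans (scan-true k<i λ { refl → ¬g t }))
             (weaken (w-bound k (≤-trans (<⇒≤ k<i) i≤)) (prove _ 0 [] t))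

    false-premise : ∀ {ρ} → ¬ Holds True ρ → (ρ ≡ none) ⊎ (∃ λ g → Premise g ρ × ¬ True g)
    false-premise {none} ¬h = inj₁ refl
    false-premise {fact} ¬h = ⊥-elim (¬h fact)
    false-premise {one h} ¬h = inj₂ (h , one , λ t → ¬h (one t))
    false-premise {two h k} ¬h with true? h
    ... | no ¬t = inj₂ (h , twoˡ , ¬t)
    ... | yes t = inj₂ (k , twoʳ , λ u → ¬h (two t u))

    do-rules : ∀ {i} m r → r + m ≡ slots → i ≤ target → ¬ True i →
      Run (Step x) (m * ruleTime) (bottomed (refute i (count i) r)) (bottomed (refute i (count i) slots))
    do-rules zero r eq i≤ ¬i rewrite trans (≡-sym (+-identityʳ r)) eq = stop
    do-rules {i} (suc m) r eq i≤ ¬i = rule-step ▷▷ do-rules m (suc r) (trans (≡-sym (+-suc r m)) eq) i≤ ¬i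
      where
      r< : r < slots
      r< = subst (r <_) eq (m<m+n r (s≤s z≤n))
      rule-step : Run (Step x) ruleTime (bottomed (refute i (count i) r)) (bottomed (refute i (count i) (suc r)))
      rule-step with false-premise (λ h → ¬i (by r r< h))
      ... | inj₁ eq = step (by-trans (skip-rule r< eq)) stop
      ... | inj₂ (g , p , ¬g) = step (by-trans (pick r< p))
        (weaken (+-monoˡ-≤ 1 (*-monoˡ-≤ (suc W) i≤)) (do-scan i 0 refl i≤ ¬g))

    do-refute : ∀ {i} → i ≤ target → ¬ True i →
      Run (Step x) (suc (slots * ruleTime)) (bottomed (main i (count i))) (bottomed (refute i (count i) slots))
    do-refute i≤ ¬i = step (by-trans guess-false) (do-rules slots 0 refl i≤ ¬i)

    do-main : ∀ m i → i + m ≡ target → ¬ True target →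
      Run (Step x) (m * gateTime + gateTime) (bottomed (main i (count i))) (accept , 0 ∷ [])
    do-main zero i eq ¬t rewrite trans (≡-sym (+-identityʳ i)) eq =
      weaken (≤-trans (≤-reflexive (+-comm (suc _) 1)) (≤-trans (≤-reflexive (+-comm 2 _)) (m≤n+m _ (suc W))))
        (do-refute ≤-refl ¬t ▷▷ step (by-trans finish) (stop {n = 0}))
    do-main (suc m) i eq ¬t =
      weaken (≤-reflexive (≡-sym (+-assoc gateTime (m * gateTime) gateTime)))
        (gate (true? i) ▷▷ do-main m (suc i) (trans (≡-sym (+-suc i m)) eq) ¬t)
      where
      i< : i < target
      i< = subst (i <_) eq (m<m+n i (s≤s z≤n))
      gate : Dec (True i) →
        Run (Step x) gateTime (bottomed (main i (count i))) (bottomed (main (suc i) (count (suc i))))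
      gate (yes t) rewrite count-yes t =
        weaken (m≤m+n (suc W) _)
          (step (by-trans (guess-true i<)) (weaken (w-bound i (<⇒≤ i<)) (prove _ 0 [] t)))
      gate (no ¬i) rewrite count-no ¬i =
        weaken (≤-trans (≤-reflexive (+-comm (suc _) 1)) (≤-trans (≤-reflexive (+-comm 2 _)) (m≤n+m _ (suc W))))
          (do-refute (<⇒≤ i<) ¬i ▷▷ step (by-trans (next-gate i<)) (stop {n = 0}))

    complement-run : ¬ True target → Run (Step x) totalTime (run (main 0 0) , 0 ∷ []) (accept , 0 ∷ [])
    complement-run = do-main target 0 refl

-- From programs to automata

tapeAt-end : ∀ {s} (x : Str s) {i} → length x < i → tapeAt x i ≡ ◁
tapeAt-end [] {suc i} _ = refl
tapeAt-end (a ∷ x) {suc (suc i)} (s≤s l<) = tapeAt-end x l<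

tapeAt-◁ : ∀ {s} (x : Str s) {i} → tapeAt x i ≡ ◁ → length x < i
tapeAt-◁ [] {suc i} _ = s≤s z≤n
tapeAt-◁ (a ∷ x) {suc (suc i)} eq = s≤s (tapeAt-◁ x eq)

_≟◁ : ∀ {s} (a : TapeSym s) → Dec (a ≡ ◁)
▷ ≟◁ = no λ ()
◁ ≟◁ = yes refl
(sym _) ≟◁ = no λ ()

module Compile {s} (P : Program s) (H : ℕ) .{{_ : NonZero H}} .{{_ : NonZero (Program.symbols P)}} where
  open Program P

  heads : Code (State × ℕ)
  heads = states ×ᶜ belowCode H

  Γ : Set
  Γ = Fin symbols

  symbol : ℕ → Γ
  symbol = clamp symbols

  Target : Set
  Target = State × ℕ × Move × List ℕ

  -- The finite control knows the head position h. By the definition of tapeAt every cell beyond ◁ reads ◁,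
  -- so such a cell need not be reached.
  react : State → ℕ → TapeSym s → ℕ → List Target
  react q h a z with <-cmp h (pos q)
  ... | tri> _ _ _ = (q , pred h , left , z ∷ []) ∷ []
  ... | tri≈ _ _ _ = map (λ { (q′ , w) → q′ , h , stay , w }) (next q a z)
  ... | tri< _ _ _ with a ≟◁
  ...   | no _  = (q , suc h , right , z ∷ []) ∷ []
  ...   | yes _ = map (λ { (q′ , w) → q′ , h , stay , w }) (next q a z)

  control : State → ℕ → Fin (bound heads)
  control q h = code heads (q , h)

  emit : Target → Fin (bound heads) × Move × List Γ
  emit (q , h , m , w) = control q h , m , map symbol w

  react-≤2 : ∀ {q h a z q′ h′ m w} → (q′ , h′ , m , w) ∈ react q h a z → length w ≤ 2
  react-≤2 {q} {h} {a} t∈ with <-cmp h (pos q)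
  react-≤2 (here refl) | tri> _ _ _ = s≤s z≤n
  react-≤2 t∈ | tri≈ _ _ _ with _ , u∈ , refl ← ∈-map⁻ _ t∈ = push≤2 u∈
  react-≤2 {a = a} t∈ | tri< _ _ _ with a ≟◁ | t∈
  ... | no _ | here refl = s≤s z≤n
  ... | yes _ | t∈ with _ , u∈ , refl ← ∈-map⁻ _ t∈ = push≤2 u∈

  emitted-≤2 : ∀ q h a z {t} → t ∈ map emit (react q h a z) → length (proj₂ (proj₂ t)) ≤ 2
  emitted-≤2 q h a z t∈ with (_ , _ , _ , w) , u∈ , refl ← ∈-map⁻ emit t∈ =
    subst (_≤ 2) (≡-sym (length-map symbol w)) (react-≤2 {q} {h} {a} u∈)

  transitions : Fin (bound heads) → TapeSym s → Γ → List (Fin (bound heads) × Move × List Γ)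
  transitions i a z = map emit (react (proj₁ (decode heads i)) (proj₂ (decode heads i)) a (toℕ z))

  pda : TwoNPDA s
  pda = record
    { nstates = bound heads ; nstack = symbols ; bottom = symbol 0
    ; start = control start 0 ; accept = control accept 0 ; reject = control reject 0
    ; e = 2
    ; δ = transitions
    ; pushBound = λ i a z _ _ _ → emitted-≤2 (proj₁ (decode heads i)) (proj₂ (decode heads i)) a (toℕ z) }

  module _ (x : Str s) (room : suc (length x) < H) where

    Good : Conf → ℕ → Set
    Good (q , γ) h = Valid states q × All (_< symbols) γ × h ≤ suc (length x)

    place : Conf → ℕ → PConf pda
    place (q , γ) h = control q h , h , map symbol γ

    valid-heads : ∀ {c h} → Good c h → Valid heads (proj₁ c , h)
    valid-heads (v , _ , h≤) = v , ≤-<-trans h≤ room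

    next-good : ∀ {q z rest q′ w h a} → Good (q , z ∷ rest) h → (q′ , w) ∈ next q a z → Good (q′ , w ++ rest) h
    next-good (v , z< ∷ rest< , h≤) u∈ =
      let v′ , w< = next-valid v z< u∈ in v′ , All-++⁺ w< rest< , h≤

    data Micro : Conf → ℕ → Move → Conf → ℕ → Set where
      back  : ∀ {q z γ h} → pos q < suc h → Micro (q , z ∷ γ) (suc h) left (q , z ∷ γ) h
      forth : ∀ {q z γ h} → h < pos q → tapeAt x h ≢ ◁ → Micro (q , z ∷ γ) h right (q , z ∷ γ) (suc h)
      act   : ∀ {q z γ h q′ w} → h ≡ pos q ⊎ (h < pos q × tapeAt x h ≡ ◁) →
              (q′ , w) ∈ next q (tapeAt x (pos q)) z → Micro (q , z ∷ γ) h stay (q′ , w ++ γ) h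

    same-symbol : ∀ {p h} → h ≡ p ⊎ (h < p × tapeAt x h ≡ ◁) → tapeAt x h ≡ tapeAt x p
    same-symbol (inj₁ refl) = refl
    same-symbol (inj₂ (h<p , eq)) = trans eq (≡-sym (tapeAt-end x (<-trans (tapeAt-◁ x eq) h<p)))

    micro-good : ∀ {c h m c′ h′} → Good c h → Micro c h m c′ h′ → Good c′ h′ × ValidMove x h m h′
    micro-good (v , γ< , h≤) (back _) = (v , γ< , ≤-trans (n≤1+n _) h≤) , refl , ≤-trans (n≤1+n _) h≤
    micro-good {h = h} (v , γ< , h≤) (forth _ ≢◁) = (v , γ< , s≤s h≤′) , move-right h , s≤s h≤′
      where
      move-right : ∀ h → move h right ≡ just (suc h)
      move-right zero = refl
      move-right (suc h) = refl
      h≤′ : h ≤ length x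
      h≤′ = ≮⇒≥ (λ l< → ≢◁ (tapeAt-end x l<))
    micro-good {h = h} g@(_ , _ , h≤) (act _ u∈) = next-good g u∈ , move-stay h , h≤
      where
      move-stay : ∀ h → move h stay ≡ just h
      move-stay zero = refl
      move-stay (suc h) = refl

    -- With the head at 0 there is no `back`, `pos q ≡ 0` excludes `forth`, and an inert state has
    -- no `act`. So the halting test of the automaton blocks no step of the program.
    Micro-active : ∀ {c h m c′ h′} → Good c h → Micro c h m c′ h′ →
      ∀ {q} → Valid states q → pos q ≡ 0 → (∀ {a z t} → ¬ (t ∈ next q a z)) → control (proj₁ c) h ≢ control q 0
    Micro-active g μ v pos≡0 inert eq
      with refl ← code-injective heads (valid-heads g) (v , ≤-<-trans z≤n room) eq = absurd μ
      where
      absurd : ∀ {c′ m h′ γ} → ¬ Micro (_ , γ) 0 m c′ h′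
      absurd (forth 0<p _) = n≮0 (subst (_ <_) pos≡0 0<p)
      absurd (act _ u∈) = inert u∈

    micro⇒react : ∀ {q z γ h m q′ γ′ h′} → Micro (q , z ∷ γ) h m (q′ , γ′) h′ →
      Σ (List ℕ) λ w → γ′ ≡ w ++ γ × (q′ , h′ , m , w) ∈ react q h (tapeAt x h) z
    micro⇒react {q} {z} (back {h = h} p<) with <-cmp (suc h) (pos q)
    ... | tri> _ _ _ = z ∷ [] , refl , here refl
    ... | tri≈ _ eq _ = ⊥-elim (<-irrefl (≡-sym eq) p<)
    ... | tri< _ _ ≯ = ⊥-elim (≯ p<)
    micro⇒react {q} {z} {h = h} (forth <p ≢◁) with <-cmp h (pos q)
    ... | tri> ≮ _ _ = ⊥-elim (≮ <p)
    ... | tri≈ ≮ _ _ = ⊥-elim (≮ <p)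
    ... | tri< _ _ _ with tapeAt x h ≟◁
    ...   | no _ = z ∷ [] , refl , here refl
    ...   | yes ≡◁ = ⊥-elim (≢◁ ≡◁)
    micro⇒react {q} {z} {h = h} (act {w = w} at u∈)
      with subst (λ a → _ ∈ next q a z) (≡-sym (same-symbol at)) u∈ | <-cmp h (pos q) | at
    ... | u∈′ | tri≈ _ _ _ | _ = w , refl , ∈-map⁺ _ u∈′
    ... | _ | tri< _ ≢p _ | inj₁ ≡p = ⊥-elim (≢p ≡p)
    ... | _ | tri> _ ≢p _ | inj₁ ≡p = ⊥-elim (≢p ≡p)
    ... | _ | tri> ≮ _ _ | inj₂ (<p , _) = ⊥-elim (≮ <p)
    ... | u∈′ | tri< _ _ _ | inj₂ (_ , ≡◁) with tapeAt x h ≟◁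
    ...   | yes _ = w , refl , ∈-map⁺ _ u∈′
    ...   | no ≢◁ = ⊥-elim (≢◁ ≡◁)

    react⇒micro : ∀ {q z γ h m q′ w h′} → (q′ , h′ , m , w) ∈ react q h (tapeAt x h) z →
      Micro (q , z ∷ γ) h m (q′ , w ++ γ) h′
    react⇒micro {q} {h = h} t∈ with <-cmp h (pos q)
    react⇒micro {h = suc h} (here refl) | tri> _ _ p< = back p<
    react⇒micro t∈ | tri≈ _ h≡ _ with _ , u∈ , refl ← ∈-map⁻ _ t∈ =
      act (inj₁ h≡) (subst (λ p → _ ∈ next _ (tapeAt x p) _) h≡ u∈)
    react⇒micro {h = h} t∈ | tri< <p _ _ with tapeAt x h ≟◁ in eq | t∈
    ... | no ≢◁ | here refl = forth <p ≢◁
    ... | yes ≡◁ | t∈ with _ , u∈ , refl ← ∈-map⁻ _ t∈ =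
      act (inj₂ (<p , ≡◁)) (subst (λ a → _ ∈ next _ a _) (same-symbol (inj₂ (<p , ≡◁))) u∈)

    micro⇒step : ∀ {c h m c′ h′} → Good c h → Micro c h m c′ h′ → PStep pda x (place c h) (place c′ h′)
    micro⇒step {c} {h} {m} {c′} {h′} g μ =
      Micro-active g μ accept-valid pos-accept next-accept ,
      Micro-active g μ reject-valid pos-reject next-reject ,
      go g μ
      where
      go : ∀ {c} → Good c h → Micro c h m c′ h′ → Σ Γ λ z → Σ (List Γ) λ rest → Σ Move λ m′ → Σ (List Γ) λ w →
        map symbol (proj₂ c) ≡ z ∷ rest ×
        (control (proj₁ c′) h′ , m′ , w) ∈ transitions (control (proj₁ c) h) (tapeAt x h) z ×
        ValidMove x h m′ h′ × map symbol (proj₂ c′) ≡ w ++ rest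
      go {q , []} g ()
      go {q , z ∷ γ} g@(_ , z< ∷ _ , _) μ with w , refl , t∈ ← micro⇒react μ =
        symbol z , map symbol γ , m , map symbol w , refl ,
        subst₂ (λ k y → _ ∈ map emit (react (proj₁ k) (proj₂ k) (tapeAt x h) y))
          (≡-sym (decode-code heads (valid-heads g))) (≡-sym (toℕ-clamp z<)) (∈-map⁺ emit t∈) ,
        proj₂ (micro-good g μ) , map-++ symbol w γ

    step⇒micro : ∀ {c h k} → Good c h → PStep pda x (place c h) k →
      Σ Conf λ c′ → ∃ λ h′ → ∃ λ m → Micro c h m c′ h′ × k ≡ place c′ h′
    step⇒micro {q , y ∷ γ} {h} g@(_ , y< ∷ _ , _) (_ , _ , z , rest , m , w , refl , t∈ , valid , refl)
      with (q′ , h′ , _ , v) , u∈ , refl ← ∈-map⁻ emit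
        (subst₂ (λ k y → _ ∈ map emit (react (proj₁ k) (proj₂ k) (tapeAt x h) y))
          (decode-code heads (valid-heads g)) (toℕ-clamp y<) t∈) =
      let μ = react⇒micro u∈ in
      (q′ , v ++ γ) , h′ , m , μ ,
      cong₂ (λ i δ → control q′ h′ , i , δ)
        (just-injective (trans (≡-sym (proj₁ valid)) (proj₁ (proj₂ (micro-good g μ)))))
        (≡-sym (map-++ symbol v γ))

    initial-good : Good (start , 0 ∷ []) 0
    initial-good = start-valid , bottom< ∷ [] , z≤n

    Reached : (Conf → Set) → PConf pda → Set
    Reached Inv k = Σ Conf λ c → ∃ λ h → Good c h × Inv c × k ≡ place c h

    module _ (Inv : Conf → Set) (pres : ∀ {c c′} → Step x c c′ → Inv c → Inv c′) where

      micro-inv : ∀ {c h m c′ h′} → Micro c h m c′ h′ → Inv c → Inv c′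
      micro-inv (back _) i = i
      micro-inv (forth _ _) i = i
      micro-inv (act _ u∈) i = pres (fire u∈) i

      preserved : ∀ {k k′} → PStep pda x k k′ → Reached Inv k → Reached Inv k′
      preserved st (c , h , g , inv , refl) with c′ , h′ , m , μ , refl ← step⇒micro g st =
        c′ , h′ , proj₁ (micro-good g μ) , micro-inv μ inv , refl

      pda-sound : Inv (start , 0 ∷ []) → (∀ {γ} → ¬ Inv (accept , γ)) → ¬ PAccepts pda x
      pda-sound init final (j , γ , run)
        with (q , δ) , h , g , inv , eq ←
               star-invariant (Reached Inv) preserved run (_ , 0 , initial-good , init , refl)
        with refl ← code-injective heads (valid-heads g) (accept-valid , ≤-<-trans z≤n room)
                      (≡-sym (cong proj₁ eq)) = final inv

    -- On the way right the fuel `n` bounds the distance to ◁ and not to `pos q`, since `pos q` may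
    -- lie beyond the tape; on the way left it bounds the distance to ▷. The extra step is the `act`
    -- itself.
    walk : ∀ {q z γ q′ w} n h → (pos q ≤ h × h ≤ n) ⊎ (h ≤ pos q × suc (length x) ∸ h ≤ n) →
      Good (q , z ∷ γ) h → (q′ , w) ∈ next q (tapeAt x (pos q)) z →
      ∃ λ h′ → Good (q′ , w ++ γ) h′ × Run (PStep pda x) (suc n) (place (q , z ∷ γ) h) (place (q′ , w ++ γ) h′)
    walk {q} n h dist g u∈ with <-cmp h (pos q)
    walk n h dist g u∈ | tri≈ _ ≡p _ =
      h , next-good g u∈ , step (micro⇒step g (act (inj₁ ≡p) u∈)) stop
    walk n h dist g u∈ | tri< <p _ _ with tapeAt x h ≟◁
    ... | yes ≡◁ = h , next-good g u∈ , step (micro⇒step g (act (inj₂ (<p , ≡◁)) u∈)) stop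
    walk n h (inj₁ (p≤ , _)) g u∈ | tri< <p _ _ | no ≢◁ = ⊥-elim (<-irrefl refl (<-≤-trans <p p≤))
    walk zero h (inj₂ (_ , d)) g u∈ | tri< <p _ _ | no ≢◁ =
      ⊥-elim (≢◁ (tapeAt-end x {h} (m∸n≡0⇒m≤n (n≤0⇒n≡0 d))))
    walk (suc n) h (inj₂ (_ , d)) g u∈ | tri< <p _ _ | no ≢◁ =
      let μ = forth <p ≢◁
          h′ , g′ , rs = walk n (suc h)
                           (inj₂ (<p , ≤-trans (≤-reflexive (≡-sym (pred[m∸n]≡m∸[1+n] _ h))) (pred-mono-≤ d)))
                           (proj₁ (micro-good g μ)) u∈
      in h′ , g′ , step (micro⇒step g μ) rs
    walk n h (inj₂ (h≤ , _)) g u∈ | tri> _ _ p< = ⊥-elim (<-irrefl refl (<-≤-trans p< h≤))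
    walk (suc n) (suc h) (inj₁ (_ , h≤)) g u∈ | tri> _ _ p< =
      let μ = back p<
          h′ , g′ , rs = walk n h (inj₁ (s≤s⁻¹ p< , s≤s⁻¹ h≤)) (proj₁ (micro-good g μ)) u∈
      in h′ , g′ , step (micro⇒step g μ) rs

    distance : ∀ {p h} → h ≤ suc (length x) → (p ≤ h × h ≤ H) ⊎ (h ≤ p × suc (length x) ∸ h ≤ H)
    distance {p} {h} h≤ with ≤-total p h
    ... | inj₁ p≤h = inj₁ (p≤h , ≤-trans h≤ (<⇒≤ room))
    ... | inj₂ h≤p = inj₂ (h≤p , ≤-trans (m∸n≤m _ h) (<⇒≤ room))

    simulate : ∀ {n c c′ h} → Good c h → Run (Step x) n c c′ →
      ∃ λ h′ → Good c′ h′ × Run (PStep pda x) (n * suc H) (place c h) (place c′ h′)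
    simulate g stop = _ , g , stop
    simulate {h = h} g@(_ , _ , h≤) (step (fire u∈) rs) =
      let _ , g₁ , rs₁ = walk H h (distance h≤) g u∈
          h′ , g′ , rs′ = simulate g₁ rs
      in h′ , g′ , rs₁ ▷▷ rs′

    -- acceptance is only recognised with the head on ▷
    rewind : ∀ {z γ} n h → h ≤ n → Good (accept , z ∷ γ) h →
      Run (PStep pda x) n (place (accept , z ∷ γ) h) (place (accept , z ∷ γ) 0)
    rewind n zero h≤ g = stop
    rewind (suc n) (suc h) h≤ g =
      let μ = back (subst (_< suc h) (≡-sym pos-accept) (s≤s z≤n))
      in step (micro⇒step g μ) (rewind n h (s≤s⁻¹ h≤) (proj₁ (micro-good g μ)))

    pda-complete : ∀ {n z γ} → Run (Step x) n (start , 0 ∷ []) (accept , z ∷ γ) →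
      Σ (List Γ) λ γ′ → Run (PStep pda x) (n * suc H + H) (initP pda) (control accept 0 , 0 , γ′)
    pda-complete rs =
      let h , g , rs′ = simulate initial-good rs
      in _ , rs′ ▷▷ rewind H h (≤-trans (proj₂ (proj₂ g)) (<⇒≤ room)) g

-- Bounding the running time by a clock in the finite control

module Clock {s} (M : TwoNPDA s) (T : ℕ) where
  open TwoNPDA M

  Halted : Fin nstates → Set
  Halted q = q ≡ accept ⊎ q ≡ reject

  halted? : ∀ q → Dec (Halted q)
  halted? q = (q ≟F accept) ⊎-dec (q ≟F reject)

  -- An automaton has a single accepting state, but runs reach `accept` at different times;
  -- resetting the clock in halting states merges these copies.
  time : ∀ {q} → Dec (Halted q) → Fin (suc T) → Fin (suc T)
  time (yes _) t = Fin.zero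
  time (no _) t = t

  tick : Fin nstates → Fin (suc T) → Fin (nstates * suc T)
  tick q t = combine q (time (halted? q) t)

  clockedδ : Fin nstates × Fin (suc T) → TapeSym s → Fin nstack →
             List (Fin (nstates * suc T) × Move × List (Fin nstack))
  clockedδ (q , Fin.zero) a z = []
  clockedδ (q , Fin.suc t) a z = map (λ { (q′ , m , w) → tick q′ (inject₁ t) , m , w }) (δ q a z)

  clocked-push : ∀ k {a z q′ m w} → (q′ , m , w) ∈ clockedδ k a z → length w ≤ e
  clocked-push (q , Fin.suc t) t∈ with _ , u∈ , refl ← ∈-map⁻ _ t∈ = pushBound _ _ _ _ _ _ u∈

  split : Fin (nstates * suc T) → Fin nstates × Fin (suc T)
  split = remQuot (suc T)

  clocked : TwoNPDA s
  clocked = record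
    { nstates = nstates * suc T ; nstack = nstack ; bottom = bottom
    ; start = tick start (clamp (suc T) T) ; accept = combine accept Fin.zero ; reject = combine reject Fin.zero
    ; e = e
    ; δ = λ i → clockedδ (split i)
    ; pushBound = λ i _ _ _ _ _ → clocked-push (split i) }

  split-tick : ∀ q t → split (tick q t) ≡ (q , time (halted? q) t)
  split-tick q t = remQuot-combine q (time (halted? q) t)

  tick-active : ∀ {q t q₀} → ¬ q ≡ q₀ → tick q t ≢ combine q₀ Fin.zero
  tick-active {q} {t} {q₀} q≢ eq = q≢ (cong proj₁
    (trans (≡-sym (split-tick q t)) (trans (cong split eq) (remQuot-combine q₀ Fin.zero))))

  remaining : PConf clocked → ℕ
  remaining (i , _) = toℕ (proj₂ (split i))

  time≤ : ∀ {q} (d : Dec (Halted q)) t → toℕ (time d t) ≤ toℕ t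
  time≤ (yes _) t = z≤n
  time≤ (no _) t = ≤-refl

  clockedδ-decreases : ∀ k {a z i m w} → (i , m , w) ∈ clockedδ k a z → toℕ (proj₂ (split i)) < toℕ (proj₂ k)
  clockedδ-decreases (q , Fin.suc t) t∈ with (q′ , _) , _ , refl ← ∈-map⁻ _ t∈ =
    s≤s (≤-trans (≤-reflexive (cong (λ k → toℕ (proj₂ k)) (split-tick q′ (inject₁ t))))
      (≤-trans (time≤ (halted? q′) (inject₁ t)) (≤-reflexive (toℕ-inject₁ t))))

  module _ (x : Str s) where

    remaining-decreases : ∀ {c c′} → PStep clocked x c c′ → remaining c′ < remaining c
    remaining-decreases {i , _} (_ , _ , z , rest , m , w , _ , t∈ , _) = clockedδ-decreases (split i) t∈

    steps≤remaining : ∀ n {c c′} → PStepsN clocked x n c c′ → n ≤ remaining c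
    steps≤remaining zero _ = z≤n
    steps≤remaining (suc n) (_ , st , sts) = ≤-<-trans (steps≤remaining n sts) (remaining-decreases st)

    clocked-halts : PHaltsWithin clocked x T
    clocked-halts c sts = <-irrefl refl (≤-trans (steps≤remaining (suc T) sts) (s≤s⁻¹ (toℕ<n _)))

    Shadow : PConf clocked → Set
    Shadow (i , rest) = ∃ λ q → ∃ λ t → i ≡ tick q t × Star (PStep M x) (initP M) (q , rest)

    shadow-preserved : ∀ {c c′} → PStep clocked x c c′ → Shadow c → Shadow c′
    shadow-preserved (_ , _ , z , rest , m , w , γ≡ , t∈ , valid , γ′≡) (q , t , refl , run)
      with halted? q | t | subst (λ k → _ ∈ clockedδ k _ _) (split-tick q t) t∈
    ... | no active | Fin.suc t | t∈ with (q′ , _) , u∈ , refl ← ∈-map⁻ _ t∈ =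
      q′ , inject₁ t , refl ,
      run ◅◅ (((λ eq → active (inj₁ eq)) , (λ eq → active (inj₂ eq)) ,
               z , rest , m , w , γ≡ , u∈ , valid , γ′≡) ◅ ε)

    clocked-sound : PAccepts clocked x → PAccepts M x
    clocked-sound (j , γ , run) =
      let q , t , eq , run′ = star-invariant Shadow shadow-preserved run (start , _ , refl , ε)
      in j , γ , subst (λ q → Star (PStep M x) (initP M) (q , j , γ))
        (cong proj₁ (trans (≡-sym (split-tick q t))
          (trans (cong split (≡-sym eq)) (remQuot-combine accept Fin.zero)))) run′

    clocked-complete : ∀ {n c c′} t → n ≤ toℕ t → Run (PStep M x) n c c′ →
      ∃ λ t′ → Star (PStep clocked x) (tick (proj₁ c) t , proj₂ c) (tick (proj₁ c′) t′ , proj₂ c′)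
    clocked-complete t n≤ stop = t , ε
    clocked-complete {c = q , rest} (Fin.suc t) (s≤s n≤)
      (step (≢a , ≢r , z , δ′ , m , w , γ≡ , u∈ , valid , γ′≡) rs) =
      let t′ , rs′ = clocked-complete (inject₁ t) (≤-trans n≤ (≤-reflexive (≡-sym (toℕ-inject₁ t)))) rs
      in t′ , (tick-active ≢a , tick-active ≢r , z , δ′ , m , w , γ≡ , enabled , valid , γ′≡) ◅ rs′
      where
      time-active : (d : Dec (Halted q)) → time d (Fin.suc t) ≡ Fin.suc t
      time-active (yes (inj₁ eq)) = ⊥-elim (≢a eq)
      time-active (yes (inj₂ eq)) = ⊥-elim (≢r eq)
      time-active (no _) = refl
      enabled : (tick _ (inject₁ t) , m , w) ∈ clockedδ (split (tick q (Fin.suc t))) _ z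
      enabled = subst (λ k → _ ∈ clockedδ k _ z)
        (≡-sym (trans (split-tick q (Fin.suc t)) (cong (q ,_) (time-active (halted? q))))) (∈-map⁺ _ u∈)

    clocked-accepts : ∀ {n j γ} → n ≤ T → Run (PStep M x) n (initP M) (accept , j , γ) → PAccepts clocked x
    clocked-accepts {n} {j} {γ} n≤ rs =
      let t , rs′ = clocked-complete (clamp (suc T) T) (≤-trans n≤ (≤-reflexive (≡-sym (toℕ-clamp (n<1+n T))))) rs
      in j , γ , subst (λ i → Star (PStep clocked x) (initP clocked) (i , j , γ))
                   (cong (combine accept) (time-accept (halted? accept))) rs′
      where
      time-accept : ∀ {t} (d : Dec (Halted accept)) → time d t ≡ Fin.zero
      time-accept (yes _) = refl
      time-accept (no active) = ⊥-elim (active (inj₁ refl))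

-- Pushdown automata that never change their bottom symbol are 2nfa's

module Stackless {s} (M : TwoNPDA s)
  (constant : ∀ {q a q′ m w} → (q′ , m , w) ∈ TwoNPDA.δ M q a (TwoNPDA.bottom M) →
    w ≡ TwoNPDA.bottom M ∷ []) where
  open TwoNPDA M

  drop-stack : Fin nstates × Move × List (Fin nstack) → Fin nstates × Move
  drop-stack (q , m , _) = q , m

  nfa : TwoNFA s
  nfa = record
    { nstates = nstates ; start = start ; accept = accept ; reject = reject
    ; δ = λ q a → map drop-stack (δ q a bottom) }

  module _ (x : Str s) where

    from-nfa : ∀ {q i q′ j} → Star (NStep nfa x) (q , i) (q′ , j) →
      Star (PStep M x) (q , i , bottom ∷ []) (q′ , j , bottom ∷ [])
    from-nfa ε = ε
    from-nfa ((≢a , ≢r , m , t∈ , valid) ◅ rs) with _ , u∈ , refl ← ∈-map⁻ drop-stack t∈ =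
      (≢a , ≢r , bottom , [] , m , bottom ∷ [] , refl ,
        subst (λ w → (_ , m , w) ∈ δ _ _ bottom) (constant u∈) u∈ , valid , refl) ◅ from-nfa rs

    to-nfa : ∀ {q i q′ j γ} → Star (PStep M x) (q , i , bottom ∷ []) (q′ , j , γ) →
      Star (NStep nfa x) (q , i) (q′ , j)
    to-nfa ε = ε
    to-nfa ((≢a , ≢r , _ , _ , m , w , refl , u∈ , valid , refl) ◅ rs) with refl ← constant u∈ =
      (≢a , ≢r , m , ∈-map⁺ drop-stack u∈ , valid) ◅ to-nfa rs

    nfa-sound : NAccepts nfa x → PAccepts M x
    nfa-sound (j , rs) = j , _ , from-nfa rs

    nfa-complete : PAccepts M x → NAccepts nfa x
    nfa-complete (j , γ , rs) = j , to-nfa rs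

-- Rule systems and their levelled circuits

record System (s : ℕ) : Set₁ where
  field
    Atom Choice : Set
    atoms   : Code Atom
    choices : Code Choice
    cell    : Atom → ℕ
    derive  : Atom → TapeSym s → Choice → Rule Atom
    premise-valid : ∀ {t a c u} → Valid atoms t → Premise u (derive t a c) → Valid atoms u

  -- The index bounds the number of inferences above the leaves.
  data Derivation (x : Str s) : ℕ → Atom → Set where
    axiom  : ∀ {n t c} → Valid choices c → derive t (tapeAt x (cell t)) c ≡ fact → Derivation x n t
    unary  : ∀ {n t c u} → Valid choices c → derive t (tapeAt x (cell t)) c ≡ one u →
             Derivation x n u → Derivation x (suc n) t
    binary : ∀ {m n t c u v} → Valid choices c → derive t (tapeAt x (cell t)) c ≡ two u v →
             Derivation x m u → Derivation x n v → Derivation x (suc (m + n)) t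

-- Gates of level j state that an atom has a derivation within budget j;
-- split says how a budget suc j may be shared between two premises.
module Levelled {s} (S : System s) .{{_ : NonZero (bound (System.atoms S))}}
  {E : Set} (splits : Code E) .{{_ : NonZero (bound (System.choices S ×ᶜ splits))}}
  (split : ℕ → E → ℕ × ℕ) (split≤ : ∀ j e → proj₁ (split j e) ≤ j × proj₂ (split j e) ≤ j)
  (goal : ℕ) where
  open System S

  A : ℕ
  A = bound atoms

  gate : ℕ → ℕ → ℕ
  gate j k = k + j * A

  index : Atom → ℕ
  index t = toℕ (code atoms t)

  index< : ∀ t → index t < A
  index< t = toℕ<n (code atoms t)

  level : ℕ → ℕ
  level g = g / A

  atomOf : ℕ → Atom
  atomOf g = decode atoms (clamp A g)

  level-gate : ∀ j {k} → k < A → level (gate j k) ≡ j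
  level-gate j {k} k< = trans (+-distrib-/-∣ʳ k (divides-refl j)) (cong₂ _+_ (m<n⇒m/n≡0 k<) (m*n/n≡m j A))

  clamp-gate : ∀ j k → clamp A (gate j k) ≡ clamp A k
  clamp-gate j k = toℕ-injective
    (trans (toℕ-fromℕ< _) (trans ([m+kn]%n≡m%n k j A) (≡-sym (toℕ-fromℕ< _))))

  atomOf-gate : ∀ j k → atomOf (gate j k) ≡ atomOf k
  atomOf-gate j k = cong (decode atoms) (clamp-gate j k)

  atomOf-index : ∀ j {t} → Valid atoms t → atomOf (gate j (index t)) ≡ t
  atomOf-index j {t} v = trans (atomOf-gate j (index t))
    (trans (cong (decode atoms) (clamp-toℕ (code atoms t))) (decode-code atoms v))

  slotCode : Code (Choice × E)
  slotCode = choices ×ᶜ splits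

  slot : ℕ → Choice × E
  slot r = decode slotCode (clamp (bound slotCode) r)

  lift : ℕ → E → Rule Atom → Rule ℕ
  lift j e none = none
  lift j e fact = fact
  lift zero e (one t) = none
  lift (suc j) e (one t) = one (gate j (index t))
  lift zero e (two t u) = none
  lift (suc j) e (two t u) = two (gate (proj₁ (split j e)) (index t)) (gate (proj₂ (split j e)) (index u))

  body : TapeSym s → ℕ → Atom → ℕ → Rule ℕ
  body a j t r = lift j (proj₂ (slot r)) (derive t a (proj₁ (slot r)))

  gate< : ∀ i {j t} → i ≤ j → gate i (index t) < suc j * A
  gate< i {t = t} i≤ = +-mono-<-≤ (index< t) (*-monoˡ-≤ A i≤)

  premise<level : ∀ {h} j e ρ → Premise h (lift j e ρ) → h < j * A
  premise<level (suc j) e (one t) one = gate< j {t = t} ≤-refl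
  premise<level (suc j) e (two t u) twoˡ = gate< (proj₁ (split j e)) {t = t} (proj₁ (split≤ j e))
  premise<level (suc j) e (two t u) twoʳ = gate< (proj₂ (split j e)) {t = u} (proj₂ (split≤ j e))

  circuit : Circuit s
  circuit = record
    { target = goal
    ; slots = bound slotCode
    ; pos = λ g → cell (atomOf g)
    ; rule = λ g a → body a (level g) (atomOf g)
    ; acyclic = λ g a r p → <-≤-trans (premise<level (level g) _ _ p) (m/n*n≤m g A) }

  module Weights (ω : ℕ → ℕ) (ω-one : ∀ j → ω j < ω (suc j))
    (ω-two : ∀ j e → ω (proj₁ (split j e)) + ω (proj₂ (split j e)) < ω (suc j)) (0<ω : 0 < ω 0) where
    open Circuit circuit

    weight : ℕ → ℕ
    weight g = ω (level g)

    ω-mono : ∀ {i j} → i ≤ j → ω i ≤ ω j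
    ω-mono i≤j = mono (≤⇒≤′ i≤j)
      where
      mono : ∀ {i j} → i ≤′ j → ω i ≤ ω j
      mono ≤′-refl = ≤-refl
      mono (≤′-step i≤j) = ≤-trans (mono i≤j) (<⇒≤ (ω-one _))

    weight-bound : ∀ g → g ≤ target → weight g ≤ ω (level goal)
    weight-bound g g≤ = ω-mono (/-monoˡ-≤ A g≤)

    weight-pos : ∀ g → 0 < weight g
    weight-pos g = <-≤-trans 0<ω (ω-mono z≤n)

    private
      lift-one : ∀ j e ρ {h} → lift j e ρ ≡ one h → ω (level h) < ω j
      lift-one zero e none ()
      lift-one zero e fact ()
      lift-one zero e (one _) ()
      lift-one zero e (two _ _) ()
      lift-one (suc j) e (one t) refl rewrite level-gate j (index< t) = ω-one j

      lift-two : ∀ j e ρ {h k} → lift j e ρ ≡ two h k → ω (level h) + ω (level k) < ω j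
      lift-two zero e none ()
      lift-two zero e fact ()
      lift-two zero e (one _) ()
      lift-two zero e (two _ _) ()
      lift-two (suc j) e (two t u) refl
        rewrite level-gate (proj₁ (split j e)) (index< t) | level-gate (proj₂ (split j e)) (index< u) = ω-two j e

    weight-one : ∀ {g a r h} → rule g a r ≡ one h → weight h < weight g
    weight-one {g} eq = lift-one (level g) _ _ eq

    weight-two : ∀ {g a r h k} → rule g a r ≡ two h k → weight h + weight k < weight g
    weight-two {g} eq = lift-two (level g) _ _ eq

  module _ (x : Str s) where
    open Truth circuit x

    body′ : ℕ → Atom → ℕ → Rule ℕ
    body′ j t = body (tapeAt x (cell t)) j t

    module Sound (Sem : Atom → Set)
      (closed : ∀ {t c} → Valid atoms t → Holds Sem (derive t (tapeAt x (cell t)) c) → Sem t) where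
      mutual
        -- Gates also exist for indices that decode to invalid atoms, and an invalid atom may be
        -- encoded as the index of another one. The claim is therefore restricted to valid atoms,
        -- and `premise-valid` keeps the recursion among them.
        sound : ∀ {g} → Valid atoms (atomOf g) → True g → Sem (atomOf g)
        sound {g} v (by r _ h) = closed v (lift-sound (level g) (proj₂ (slot r)) _ (premise-valid v) h)

        lift-sound : ∀ j e ρ → (∀ {u} → Premise u ρ → Valid atoms u) → Holds True (lift j e ρ) → Holds Sem ρ
        lift-sound j e fact valid fact = fact
        lift-sound (suc j) e (one t) valid (one p) = one (premise-sound j (valid one) p)
        lift-sound (suc j) e (two t u) valid (two p q) =
          two (premise-sound (proj₁ (split j e)) (valid twoˡ) p) (premise-sound (proj₂ (split j e)) (valid twoʳ) q)

        premise-sound : ∀ i {t} → Valid atoms t → True (gate i (index t)) → Sem t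
        premise-sound i v p =
          subst Sem (atomOf-index i v) (sound (subst (Valid atoms) (≡-sym (atomOf-index i v)) v) p)

    intro : ∀ {g j t c e} → level g ≡ j → atomOf g ≡ t → Valid choices c → Valid splits e →
      Holds True (lift j e (derive t (tapeAt x (cell t)) c)) → True g
    intro {g} {c = c} {e} refl refl vc ve h = by (toℕ (code slotCode (c , e))) (toℕ<n (code slotCode (c , e)))
      (subst (λ k → Holds True (lift (level g) (proj₂ k) (derive (atomOf g) (tapeAt x (cell (atomOf g))) (proj₁ k))))
        (≡-sym (trans (cong (decode slotCode) (clamp-toℕ (code slotCode (c , e)))) (decode-code slotCode (vc , ve)))) h)

    Covers : ℕ → Set
    Covers j = ∀ {m n} → m + n ≤ j → Σ E λ e → Valid splits e × m ≤ proj₁ (split j e) × n ≤ proj₂ (split j e)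

    -- Every division of a smaller budget has to be offered by some split. Axioms and unary rules
    -- ignore the split, but a slot carries one, and the given valid split fills it.
    complete : ∀ {m t} j → Σ E (Valid splits) → (∀ {i} → i < j → Covers i) → m ≤ j → Valid atoms t →
      Derivation x m t → True (gate j (index t))
    complete {t = t} j (e , ve) covers m≤ v (axiom vc eq) =
      intro {e = e} (level-gate j (index< t)) (atomOf-index j v) vc ve
        (subst (λ ρ → Holds True (lift j _ ρ)) (≡-sym eq) fact)
    complete {t = t} (suc j) (e , ve) covers m≤ v (unary vc eq d) =
      intro {e = e} (level-gate (suc j) (index< t)) (atomOf-index (suc j) v) vc ve
        (subst (λ ρ → Holds True (lift (suc j) _ ρ)) (≡-sym eq)
          (one (complete j (e , ve) (λ i< → covers (m≤n⇒m≤1+n i<)) (s≤s⁻¹ m≤)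
                 (premise-valid v (subst (Premise _) (≡-sym eq) one)) d)))
    complete {t = t} (suc j) e₀ covers (s≤s m≤) v (binary vc eq d₁ d₂)
      with e , ve , m≤ , n≤ ← covers ≤-refl m≤ =
      intro {e = e} (level-gate (suc j) (index< t)) (atomOf-index (suc j) v) vc ve
        (subst (λ ρ → Holds True (lift (suc j) _ ρ)) (≡-sym eq)
          (two (complete _ e₀ (λ i< → covers (<-≤-trans i< (m≤n⇒m≤1+n (proj₁ (split≤ j e))))) m≤
                 (premise-valid v (subst (Premise _) (≡-sym eq) twoˡ)) d₁)
               (complete _ e₀ (λ i< → covers (<-≤-trans i< (m≤n⇒m≤1+n (proj₂ (split≤ j e))))) n≤
                 (premise-valid v (subst (Premise _) (≡-sym eq) twoʳ)) d₂)))

-- Stabilisation of depth-bounded truth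

module _ {P Q : ℕ → Set} (P? : ∀ k → Dec (P k)) (Q? : ∀ k → Dec (Q k)) where
  open Counting

  count-mono : ∀ n → (∀ {k} → k < n → P k → Q k) → count P? n ≤ count Q? n
  count-mono zero _ = z≤n
  count-mono (suc n) P⊆Q with P? n | Q? n
  ... | yes p | no ¬q = ⊥-elim (¬q (P⊆Q ≤-refl p))
  ... | yes _ | yes _ = s≤s (count-mono n (λ k< → P⊆Q (m≤n⇒m≤1+n k<)))
  ... | no _ | yes _ = m≤n⇒m≤1+n (count-mono n (λ k< → P⊆Q (m≤n⇒m≤1+n k<)))
  ... | no _ | no _ = count-mono n (λ k< → P⊆Q (m≤n⇒m≤1+n k<))

  count-strict : ∀ n → (∀ {k} → k < n → P k → Q k) → ∀ {i} → i < n → ¬ P i → Q i → count P? n < count Q? n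
  count-strict (suc n) P⊆Q {i} i< ¬p q with m≤n⇒m<n∨m≡n (s≤s⁻¹ i<)
  ... | inj₂ refl = subst₂ _<_ (≡-sym (count-no P? ¬p)) (≡-sym (count-yes Q? q))
                      (s≤s (count-mono n (λ k< → P⊆Q (m≤n⇒m≤1+n k<))))
  ... | inj₁ i<n with P? n | Q? n
  ...   | yes p | no ¬q = ⊥-elim (¬q (P⊆Q ≤-refl p))
  ...   | yes _ | yes _ = s≤s (count-strict n (λ k< → P⊆Q (m≤n⇒m≤1+n k<)) i<n ¬p q)
  ...   | no _ | yes _ = m≤n⇒m≤1+n (count-strict n (λ k< → P⊆Q (m≤n⇒m≤1+n k<)) i<n ¬p q)
  ...   | no _ | no _ = count-strict n (λ k< → P⊆Q (m≤n⇒m≤1+n k<)) i<n ¬p q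

trivial : Code ⊤
trivial = record
  { bound = 1 ; code = λ _ → Fin.zero ; decode = λ _ → tt ; Valid = λ _ → ⊤ ; decode-code = λ _ → refl }

-- With both premises getting the whole remaining budget, levels bound the depth of derivations.
module Depth {s} (S : System s) .{{_ : NonZero (bound (System.atoms S))}}
  .{{_ : NonZero (bound (System.choices S ×ᶜ trivial))}} (goal : ℕ) where
  open System S

  open Levelled S trivial (λ j _ → j , j) (λ j _ → ≤-refl , ≤-refl) goal public

  -- This is `2^(j+1) - 1`, the number of nodes of the complete binary tree of depth `j`.
  ω : ℕ → ℕ
  ω zero = 1
  ω (suc j) = suc (ω j + ω j)

  open Weights ω (λ j → s≤s (m≤m+n (ω j) (ω j))) (λ j _ → ≤-refl) ≤-refl public

  module _ (x : Str s) where
    open Truth circuit x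

    transfer : ∀ {i j k} → k < A → (∀ {ρ} → Holds True (lift i tt ρ) → Holds True (lift j tt ρ)) →
      True (gate i k) → True (gate j k)
    transfer {i} {j} {k} k< f (by r r< h) = by r r<
      (subst₂ (λ ℓ t → Holds True (body′ x ℓ t r)) (≡-sym (level-gate j k<)) (≡-sym (atomOf-gate j k))
        (f (subst₂ (λ ℓ t → Holds True (body′ x ℓ t r)) (level-gate i k<) (atomOf-gate i k) h)))

    from-zero : ∀ {j k} → k < A → True (gate 0 k) → True (gate j k)
    from-zero {j} k< = transfer {0} {j} k< (λ {ρ} → lift-zero ρ)
      where
      lift-zero : ∀ ρ → Holds True (lift 0 tt ρ) → Holds True (lift j tt ρ)
      lift-zero fact fact = fact

    raise : ∀ {i j k} → (∀ {k} → k < A → True (gate i k) → True (gate j k)) →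
      k < A → True (gate (suc i) k) → True (gate (suc j) k)
    raise {i} {j} i⊆j k< = transfer {suc i} {suc j} k< (λ {ρ} → lift-suc ρ)
      where
      lift-suc : ∀ ρ → Holds True (lift (suc i) tt ρ) → Holds True (lift (suc j) tt ρ)
      lift-suc fact fact = fact
      lift-suc (one t) (one p) = one (i⊆j (index< t) p)
      lift-suc (two t u) (two p q) = two (i⊆j (index< t) p) (i⊆j (index< u) q)

    level-suc : ∀ j {k} → k < A → True (gate j k) → True (gate (suc j) k)
    level-suc zero = from-zero {1}
    level-suc (suc j) = raise {j} {suc j} (λ {k} → level-suc j {k})

    level-mono : ∀ {i j k} → i ≤ j → k < A → True (gate i k) → True (gate j k)
    level-mono {i} {k = k} i≤j k< t = mono (≤⇒≤′ i≤j)
      where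
      mono : ∀ {j} → i ≤′ j → True (gate j k)
      mono ≤′-refl = t
      mono (≤′-step {j} i≤j) = level-suc j k< (mono i≤j)

    Stable : ℕ → Set
    Stable i = ∀ {k} → k < A → True (gate (suc i) k) → True (gate i k)

    -- A level is computed from the one before it: containment of level `j` in level `i` passes to
    -- their successors by `raise`, and stability leads from level `suc i` back to `i`.
    stable-top : ∀ {i} → Stable i → ∀ j {k} → k < A → True (gate j k) → True (gate i k)
    stable-top {i} st zero k< = from-zero {i} k<
    stable-top {i} st (suc j) k< t = st k< (raise {j} {i} (λ {k} → stable-top {i} st j {k}) k< t)

    at? : ∀ j k → Dec (True (gate j k))
    at? j k = true? (gate j k)

    -- Truth is monotone in the level, so a level that is not stable gains at least one atom. As
    -- there are only `A` indices, a stable level occurs among the levels up to `A`.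
    grow : ∀ j → (∃ λ i → i < j × Stable i) ⊎ j ≤ Counting.count (at? j) A
    grow zero = inj₂ z≤n
    grow (suc j) with grow j
    ... | inj₁ (i , i< , st) = inj₁ (i , m≤n⇒m≤1+n i< , st)
    ... | inj₂ j≤ with anyUpTo? (λ k → at? (suc j) k ×-dec ¬? (at? j k)) A
    ...   | yes (k , k< , t , ¬t) = inj₂ (≤-<-trans j≤ (count-strict (at? j) (at? (suc j)) A (level-suc j) k< ¬t t))
    ...   | no stuck = inj₁ (j , ≤-refl , stable)
      where
      stable : Stable j
      stable {k} k< t with at? j k
      ... | yes t′ = t′
      ... | no ¬t = ⊥-elim (stuck (k , k< , t , ¬t))

    stabilise : ∀ j {k} → k < A → True (gate j k) → True (gate A k)
    stabilise j k< t with grow (suc A)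
    ... | inj₁ (i , i< , st) = level-mono (s≤s⁻¹ i<) k< (stable-top {i} st j k< t)
    ... | inj₂ A< = ⊥-elim (<-irrefl refl (≤-trans A< (Counting.count≤ (at? (suc A)) A)))

    -- A derivation of size `m` has depth at most `m`, hence is found at level `m`. That number is
    -- not bounded in terms of `A`; `stabilise` brings the level down.
    derivable : ∀ {m t} → Valid atoms t → Derivation x m t → True (gate A (index t))
    derivable {m} {t} v d = stabilise m (index< t)
      (complete x m (tt , tt) (λ _ m+n≤ → tt , tt , ≤-trans (m≤m+n _ _) m+n≤ , ≤-trans (m≤n+m _ _) m+n≤) ≤-refl v d)

-- The rule systems of automata

_≟ᵐ_ : DecidableEquality Move
left ≟ᵐ left = yes refl
left ≟ᵐ stay = no λ ()
left ≟ᵐ right = no λ ()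
stay ≟ᵐ left = no λ ()
stay ≟ᵐ stay = yes refl
stay ≟ᵐ right = no λ ()
right ≟ᵐ left = no λ ()
right ≟ᵐ stay = no λ ()
right ≟ᵐ right = yes refl

Fin⇒NonZero : ∀ {n} → Fin n → NonZero n
Fin⇒NonZero {suc n} _ = _

-- The Horner form, matching the recursion of `number` on the first letter.
wordsUpTo-suc : ∀ g k → wordsUpTo g (suc k) ≡ suc (wordsUpTo g k * g)
wordsUpTo-suc g zero = cong suc (*-comm g 1)
wordsUpTo-suc g (suc k) = trans (cong (_+ g ^ suc (suc k)) (wordsUpTo-suc g k)) (lemma g (wordsUpTo g k) (g ^ suc k))
  where
  lemma : ∀ g W p → suc (W * g) + g * p ≡ suc ((W + p) * g)
  lemma = solve-∀

wordsUpTo-mono : ∀ g {k e} → k ≤ e → wordsUpTo g k ≤ wordsUpTo g e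
wordsUpTo-mono g k≤e = mono (≤⇒≤′ k≤e)
  where
  mono : ∀ {k e} → k ≤′ e → wordsUpTo g k ≤ wordsUpTo g e
  mono ≤′-refl = ≤-refl
  mono (≤′-step k≤e) = ≤-trans (mono k≤e) (m≤m+n _ _)

-- Bijective base-g numeration: words of length at most e get exactly the numbers below wordsUpTo g e.
module Words (g : ℕ) .{{_ : NonZero g}} where

  number : List (Fin g) → ℕ
  number [] = 0
  number (z ∷ w) = suc (toℕ z + number w * g)

  -- The reason for this numeration: suffixes of a word with a small number have small numbers, so
  -- rules that consume a word letter by letter stay among valid atoms.
  number-tail : ∀ z w → number w < number (z ∷ w)
  number-tail z w = s≤s (≤-trans (m≤m*n (number w) g) (m≤n+m _ (toℕ z)))

  number< : ∀ w → number w < wordsUpTo g (length w)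
  number< [] = s≤s z≤n
  number< (z ∷ w) = subst (number (z ∷ w) <_) (≡-sym (wordsUpTo-suc g (length w)))
    (s≤s (≤-trans (+-monoˡ-≤ (number w * g) (toℕ<n z)) (*-monoˡ-≤ g (number< w))))

  number-bound : ∀ {w e} → length w ≤ e → number w < wordsUpTo g e
  number-bound {w} w≤ = <-≤-trans (number< w) (wordsUpTo-mono g w≤)

  word : ℕ → ℕ → List (Fin g)
  word fuel zero = []
  word zero (suc n) = []
  word (suc fuel) (suc n) = clamp g n ∷ word fuel (n / g)

  word-number : ∀ fuel w → number w ≤ fuel → word fuel (number w) ≡ w
  word-number fuel [] _ = refl
  word-number (suc fuel) (z ∷ w) (s≤s w≤) = cong₂ _∷_
    (toℕ-injective (trans (toℕ-fromℕ< _) (trans ([m+kn]%n≡m%n (toℕ z) (number w) g) (m<n⇒m%n≡m (toℕ<n z)))))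
    (trans (cong (word fuel) (trans (+-distrib-/-∣ʳ (toℕ z) (divides-refl (number w)))
             (cong₂ _+_ (m<n⇒m/n≡0 (toℕ<n z)) (m*n/n≡m (number w) g))))
      (word-number fuel w (≤-trans (s≤s⁻¹ (number-tail z w)) w≤)))

  wordCode : ∀ b .{{_ : NonZero b}} → Code (List (Fin g))
  wordCode b = codeVia number (λ n → word n n) (λ w → word-number (number w) w ≤-refl) (belowCode b)

finCode : ∀ {n} .{{_ : NonZero n}} b .{{_ : NonZero b}} → Code (Fin n)
finCode {n} b = codeVia toℕ (clamp n) clamp-toℕ (belowCode b)

moveCode : ∀ b .{{_ : NonZero b}} → Code Move
moveCode b = codeVia to from from-to (belowCode b)
  where
  to : Move → ℕ
  to left = 0
  to stay = 1
  to right = 2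
  from : ℕ → Move
  from 0 = left
  from 1 = stay
  from _ = right
  from-to : ∀ m → from (to m) ≡ m
  from-to left = refl
  from-to stay = refl
  from-to right = refl

moveCode-valid : ∀ {b} .{{_ : NonZero b}} → 3 ≤ b → ∀ m → Valid (moveCode b) m
moveCode-valid 3≤b left = ≤-trans (s≤s z≤n) 3≤b
moveCode-valid 3≤b stay = ≤-trans (s≤s (s≤s z≤n)) 3≤b
moveCode-valid 3≤b right = 3≤b

maybeCode : ∀ {T} → T → ∀ b .{{_ : NonZero b}} → Code T → Code (Maybe T)
maybeCode {T} t₀ b c = codeVia to from from-to (belowCode b ×ᶜ c)
  where
  to : Maybe T → ℕ × T
  to nothing = 0 , t₀
  to (just t) = 1 , t
  from : ℕ × T → Maybe T
  from (0 , _) = nothing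
  from (_ , t) = just t
  from-to : ∀ m → from (to m) ≡ m
  from-to nothing = refl
  from-to (just _) = refl

module _ {s} (x : Str s) where

  -- `ValidMove` refers to the length of `x`, which no rule can see. For a head on the tape its
  -- bound amounts to not moving right from ◁, a test on the symbol read.
  valid⇒≢◁ : ∀ {i m j} → ValidMove x i m j → m ≡ right → tapeAt x i ≢ ◁
  valid⇒≢◁ {i} (eq , j≤) refl ≡◁ with just-injective (trans (≡-sym eq) (move-right i))
    where
    move-right : ∀ i → move i right ≡ just (suc i)
    move-right zero = refl
    move-right (suc i) = refl
  ... | refl = <-irrefl refl (≤-<-trans (s≤s⁻¹ j≤) (tapeAt-◁ x ≡◁))

  ≢◁⇒valid : ∀ {i m j} → i ≤ suc (length x) → (m ≡ right → tapeAt x i ≢ ◁) → move i m ≡ just j → ValidMove x i m j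
  ≢◁⇒valid {suc i} {left} i≤ _ refl = refl , <⇒≤ i≤
  ≢◁⇒valid {zero} {stay} i≤ _ refl = refl , i≤
  ≢◁⇒valid {suc i} {stay} i≤ _ refl = refl , i≤
  ≢◁⇒valid {zero} {right} i≤ _ refl = refl , s≤s z≤n
  ≢◁⇒valid {suc i} {right} i≤ ≢◁ refl = refl , s≤s (≮⇒≥ (λ l< → ≢◁ refl (tapeAt-end x {suc i} l<)))

choose : ∀ {P G : Set} → Dec P → Rule G → Rule G
choose (yes _) ρ = ρ
choose (no _) ρ = none

choose-yes : ∀ {P G : Set} (d : Dec P) {ρ : Rule G} → P → choose d ρ ≡ ρ
choose-yes (yes _) _ = refl
choose-yes (no ¬p) p = ⊥-elim (¬p p)

-- The rule system of a 2nfa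

module NFASystem {s} (M : TwoNFA s) (b : ℕ) .{{_ : NonZero b}} (states≤ : TwoNFA.nstates M ≤ b) (3≤b : 3 ≤ b) where
  open TwoNFA M

  instance
    states≢0 : NonZero nstates
    states≢0 = Fin⇒NonZero start

  Atom Choice : Set
  Atom = Fin nstates × ℕ
  Choice = Fin nstates × Move

  atoms : Code Atom
  atoms = finCode b ×ᶜ belowCode b

  choices : Code Choice
  choices = finCode b ×ᶜ moveCode b

  Enabled : Fin nstates → TapeSym s → Choice → ℕ → Set
  Enabled q a (q′ , m) j =
    ¬ q ≡ reject × (q′ , m) ∈ δ q a × (m ≡ right → ¬ a ≡ ◁) × j < b

  enabled? : ∀ q a c j → Dec (Enabled q a c j)
  enabled? q a (q′ , m) j = ¬? (q ≟F reject) ×-dec _∈?_ (Product.≡-dec _≟F_ _≟ᵐ_) (q′ , m) (δ q a) ×-dec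
    ((m ≟ᵐ right) →-dec ¬? (a ≟◁)) ×-dec (j <? b)

  proceed : Atom → TapeSym s → Choice → Maybe ℕ → Rule Atom
  proceed (q , i) a (q′ , m) nothing = none
  proceed (q , i) a (q′ , m) (just j) = choose (enabled? q a (q′ , m) j) (one (q′ , j))

  derive : Atom → TapeSym s → Choice → Rule Atom
  derive (q , i) a (q′ , m) with q ≟F accept
  ... | yes _ = fact
  ... | no _ = proceed (q , i) a (q′ , m) (move i m)

  data Derives : Atom → TapeSym s → Choice → Rule Atom → Set where
    none : ∀ {t a c} → Derives t a c none
    fact : ∀ {i a c} → Derives (accept , i) a c fact
    one  : ∀ {q i a q′ m j} → ¬ q ≡ accept → Enabled q a (q′ , m) j → move i m ≡ just j →
           Derives (q , i) a (q′ , m) (one (q′ , j))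

  derives : ∀ t a c → Derives t a c (derive t a c)
  derives (q , i) a (q′ , m) with q ≟F accept
  ... | yes refl = fact
  ... | no ≢a with move i m in eq
  ...   | nothing = none
  ...   | just j with enabled? q a (q′ , m) j
  ...     | yes en = one ≢a en eq
  ...     | no _ = none

  premise-valid : ∀ {t a c u} → Valid atoms t → Premise u (derive t a c) → Valid atoms u
  premise-valid {t} {a} {c} v p with derive t a c | derives t a c | p
  ... | _ | one _ (_ , _ , _ , j<) _ | one = <-≤-trans (toℕ<n _) states≤ , j<

  system : System s
  system = record
    { atoms = atoms ; choices = choices ; cell = proj₂ ; derive = derive
    ; premise-valid = λ {t} {a} {c} → premise-valid {t} {a} {c} }

  open System system using (Derivation; axiom; unary)

  initial : Atom
  initial = start , 0

  initial-valid : Valid atoms initial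
  initial-valid = <-≤-trans (toℕ<n start) states≤ , ≤-trans (s≤s z≤n) 3≤b

  linear : ∀ t a c {u v} → derive t a c ≢ two u v
  linear t a c eq with derive t a c | derives t a c
  linear t a c () | _ | none
  linear t a c () | _ | fact
  linear t a c () | _ | one _ _ _

  module _ (x : Str s) where

    -- Atoms have all head positions below `b`; those beyond the tape of `x` are no configurations,
    -- and nothing is claimed of them.
    Sem : Atom → Set
    Sem (q , i) = i ≤ suc (length x) → ∃ λ j → Star (NStep M x) (q , i) (accept , j)

    closed : ∀ {t c} → Valid atoms t → Holds Sem (derive t (tapeAt x (proj₂ t)) c) → Sem t
    closed {t} {c} _ h i≤ with derive t (tapeAt x (proj₂ t)) c | derives t (tapeAt x (proj₂ t)) c | h
    ... | _ | fact | fact = _ , ε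
    ... | _ | one ≢a (≢r , t∈ , ≢◁ , _) eq | one sem =
      let valid = ≢◁⇒valid x i≤ ≢◁ eq
          j , rs = sem (proj₂ valid)
      in j , (≢a , ≢r , _ , t∈ , valid) ◅ rs

    derivation : suc (length x) < b → ∀ {n q i j} → Run (NStep M x) n (q , i) (accept , j) → Derivation x n (q , i)
    derivation room {q = q} {i} stop = axiom {c = q , stay}
      (<-≤-trans (toℕ<n q) states≤ , moveCode-valid 3≤b stay) accepted
      where
      accepted : derive (accept , i) (tapeAt x i) (accept , stay) ≡ fact
      accepted with accept ≟F accept
      ... | yes _ = refl
      ... | no ≢a = ⊥-elim (≢a refl)
    derivation room {q = q} {i} (step {b = q′ , j} (≢a , ≢r , m , t∈ , valid) rs) =
      unary {c = q′ , m} (<-≤-trans (toℕ<n q′) states≤ , moveCode-valid 3≤b m) applied (derivation room rs)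
      where
      applied : derive (q , i) (tapeAt x i) (q′ , m) ≡ one (q′ , j)
      applied with q ≟F accept
      ... | yes ≡a = ⊥-elim (≢a ≡a)
      ... | no _ rewrite proj₁ valid =
        choose-yes (enabled? q (tapeAt x i) (q′ , m) j)
          (≢r , t∈ , (λ m≡ → valid⇒≢◁ x valid m≡) , ≤-<-trans (proj₂ valid) room)

-- The rule system of a 2npda

module PDASystem {s} (M : TwoNPDA s) (b : ℕ) .{{_ : NonZero b}} (states≤ : TwoNPDA.nstates M ≤ b)
  (words≤ : wordsUpTo (TwoNPDA.nstack M) (TwoNPDA.e M) ≤ b) (3≤b : 3 ≤ b) where
  open TwoNPDA M

  instance
    states≢0 : NonZero nstates
    states≢0 = Fin⇒NonZero start
    stack≢0 : NonZero nstack
    stack≢0 = Fin⇒NonZero bottom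

  open Words nstack

  first : Fin nstack
  first = clamp nstack 0

  -- If e = 0 the size does not bound the number of stack symbols; the initial stack still needs a small
  -- number, so bottom is made the first symbol.
  label : List (Fin nstack) → ℕ
  label w = number (map (transpose bottom first) w)

  stackCode : Code (List (Fin nstack))
  stackCode = codeVia (map (transpose bottom first)) (map (transpose first bottom))
    (λ w → trans (≡-sym (map-∘ w)) (trans (map-cong (λ _ → transpose-inverse first bottom) w) (map-id w)))
    (wordCode b)

  Q Word : Set
  Q = Fin nstates
  Word = List (Fin nstack)

  -- (q , i , w , just (q′ , i′)): from state q and cell i the word w is popped, ending in state q′ at cell i′.
  -- (q , i , w , nothing): the machine accepts without going below w.
  Atom Choice : Set
  Atom = Q × ℕ × Word × Maybe (Q × ℕ)
  Choice = Q × Move × Word × Maybe (Q × ℕ)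

  exits : Code (Maybe (Q × ℕ))
  exits = maybeCode (start , 0) b (finCode b ×ᶜ belowCode b)

  atoms : Code Atom
  atoms = finCode b ×ᶜ belowCode b ×ᶜ stackCode ×ᶜ exits

  choices : Code Choice
  choices = finCode b ×ᶜ moveCode b ×ᶜ stackCode ×ᶜ exits

  cell : Atom → ℕ
  cell (_ , i , _) = i

  data Settled : Atom → Set where
    popped   : ∀ {q i} → Settled (q , i , [] , just (q , i))
    accepted : ∀ {i w} → Settled (accept , i , w , nothing)

  settled? : ∀ t → Dec (Settled t)
  settled? (q , i , z ∷ w , just _) = no λ ()
  settled? (q , i , [] , just (q′ , i′)) with q ≟F q′ | i ≟ i′
  ... | yes refl | yes refl = yes popped
  ... | no ≢ | _ = no λ { popped → ≢ refl }
  ... | _ | no ≢ = no λ { popped → ≢ refl }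
  settled? (q , i , w , nothing) with q ≟F accept
  ... | yes refl = yes accepted
  ... | no ≢ = no λ { accepted → ≢ refl }

  Enabled : Q → TapeSym s → Fin nstack → Q × Move × Word → ℕ → Set
  Enabled q a z (q₁ , m , w₁) j =
    ¬ q ≡ accept × ¬ q ≡ reject × (q₁ , m , w₁) ∈ δ q a z × (m ≡ right → ¬ a ≡ ◁) × j < b

  enabled? : ∀ q a z u j → Dec (Enabled q a z u j)
  enabled? q a z (q₁ , m , w₁) j = ¬? (q ≟F accept) ×-dec ¬? (q ≟F reject) ×-dec
    _∈?_ (Product.≡-dec _≟F_ (Product.≡-dec _≟ᵐ_ (≡-dec _≟F_))) (q₁ , m , w₁) (δ q a z) ×-dec
    ((m ≟ᵐ right) →-dec ¬? (a ≟◁)) ×-dec (j <? b)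

  -- The guess is where the pushed word `w₁` has been popped, or `nothing` if the run accepts before
  -- that. In the latter case `w` is never reached, so there is only one premise.
  follow : Q → ℕ → Word → Maybe (Q × ℕ) → Word → Maybe (Q × ℕ) → Rule Atom
  follow q₁ j w₁ (just (q₂ , i₂)) w τ = choose (i₂ <? b) (two (q₁ , j , w₁ , just (q₂ , i₂)) (q₂ , i₂ , w , τ))
  follow q₁ j w₁ nothing w nothing = one (q₁ , j , w₁ , nothing)
  follow q₁ j w₁ nothing w (just _) = none

  proceed : Atom → TapeSym s → Choice → Rule Atom
  proceed (q , i , [] , τ) a _ = none
  proceed (q , i , z ∷ w , τ) a (q₁ , m , w₁ , μ) with move i m
  ... | nothing = none
  ... | just j = choose (enabled? q a z (q₁ , m , w₁) j) (follow q₁ j w₁ μ w τ)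

  derive : Atom → TapeSym s → Choice → Rule Atom
  derive t a c with settled? t
  ... | yes _ = fact
  ... | no _ = proceed t a c

  data Derives : Atom → TapeSym s → Choice → Rule Atom → Set where
    none : ∀ {t a c} → Derives t a c none
    fact : ∀ {t a c} → Settled t → Derives t a c fact
    one  : ∀ {q i z w a q₁ m w₁ j} → Enabled q a z (q₁ , m , w₁) j → move i m ≡ just j →
           Derives (q , i , z ∷ w , nothing) a (q₁ , m , w₁ , nothing) (one (q₁ , j , w₁ , nothing))
    two  : ∀ {q i z w τ a q₁ m w₁ j q₂ i₂} → Enabled q a z (q₁ , m , w₁) j → move i m ≡ just j → i₂ < b →
           Derives (q , i , z ∷ w , τ) a (q₁ , m , w₁ , just (q₂ , i₂))
                   (two (q₁ , j , w₁ , just (q₂ , i₂)) (q₂ , i₂ , w , τ))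

  derives : ∀ t a c → Derives t a c (derive t a c)
  derives t a c with settled? t
  ... | yes st = fact st
  derives (q , i , [] , τ) a c | no _ = none
  derives (q , i , z ∷ w , τ) a (q₁ , m , w₁ , μ) | no _ with move i m in eq
  ... | nothing = none
  ... | just j with enabled? q a z (q₁ , m , w₁) j
  ...   | no _ = none
  ...   | yes en with μ | τ
  ...     | nothing | nothing = one en eq
  ...     | nothing | just _ = none
  ...     | just (q₂ , i₂) | _ with i₂ <? b
  ...       | yes i₂< = two en eq i₂<
  ...       | no _ = none

  state< : ∀ (q : Q) → toℕ q < b
  state< q = <-≤-trans (toℕ<n q) states≤

  1<b : 1 < b
  1<b = ≤-trans (s≤s (s≤s z≤n)) 3≤b

  0<b : 0 < b
  0<b = <⇒≤ 1<b

  exit-valid : ∀ {q i} → i < b → Valid exits (just (q , i))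
  exit-valid {q} i< = 1<b , state< q , i<

  no-exit-valid : Valid exits nothing
  no-exit-valid = 0<b , state< start , 0<b

  pushed-valid : ∀ {q a z q₁ m w₁} → (q₁ , m , w₁) ∈ δ q a z → label w₁ < b
  pushed-valid {w₁ = w₁} t∈ = <-≤-trans (number-bound {map _ w₁}
    (≤-trans (≤-reflexive (length-map _ w₁)) (pushBound _ _ _ _ _ _ t∈))) words≤

  premise-valid : ∀ {t a c u} → Valid atoms t → Premise u (derive t a c) → Valid atoms u
  premise-valid {t} {a} {c} v p with derive t a c | derives t a c | v | p
  ... | _ | one (_ , _ , t∈ , _ , j<) _ | _ | one = state< _ , j< , pushed-valid t∈ , no-exit-valid
  ... | _ | two (_ , _ , t∈ , _ , j<) _ i₂< | _ | twoˡ = state< _ , j< , pushed-valid t∈ , exit-valid i₂<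
  ... | _ | two {z = z} {w = w} _ _ i₂< | _ , _ , zw< , τ< | twoʳ =
    state< _ , i₂< , <-trans (number-tail (transpose bottom first z) (map _ w)) zw< , τ<

  initial : Atom
  initial = start , 0 , bottom ∷ [] , nothing

  initial-valid : Valid atoms initial
  initial-valid = state< start , 0<b ,
    subst (λ z → number (z ∷ []) < b) (≡-sym (transpose-ij bottom))
      (subst (λ n → suc (n + 0) < b) (≡-sym (toℕ-clamp {nstack} {0} (>-nonZero⁻¹ nstack))) 1<b) , no-exit-valid
    where
    transpose-ij : ∀ i → transpose i first i ≡ first
    transpose-ij i with i ≟F i
    ... | yes _ = refl
    ... | no ≢ = ⊥-elim (≢ refl)

  system : System s
  system = record
    { atoms = atoms ; choices = choices ; cell = cell ; derive = derive
    ; premise-valid = λ {t} {a} {c} → premise-valid {t} {a} {c} }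

  open System system using (Derivation; axiom; unary; binary)

  module _ (x : Str s) where

    -- Quantifying over the stack `γ` below the word makes runs composable: in a `two` rule the
    -- first premise is used above `w ++ γ`, the second above `γ`.
    Sem : Atom → Set
    Sem (q , i , w , just (q′ , i′)) = i ≤ suc (length x) →
      ∀ γ → Star (PStep M x) (q , i , w ++ γ) (q′ , i′ , γ)
    Sem (q , i , w , nothing) = i ≤ suc (length x) →
      ∀ γ → ∃ λ j → Σ Word λ γ′ → Star (PStep M x) (q , i , w ++ γ) (accept , j , γ′)

    on-tape : ∀ {c c′} → Star (PStep M x) c c′ → proj₁ (proj₂ c) ≤ suc (length x) → proj₁ (proj₂ c′) ≤ suc (length x)
    on-tape = star-invariant (λ c → proj₁ (proj₂ c) ≤ suc (length x))
      λ { (_ , _ , _ , _ , _ , _ , _ , _ , (_ , j≤) , _) _ → j≤ }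

    enabled-step : ∀ {q i z w q₁ m w₁ j} → i ≤ suc (length x) → Enabled q (tapeAt x i) z (q₁ , m , w₁) j →
      move i m ≡ just j →
      ∀ γ → PStep M x (q , i , z ∷ w ++ γ) (q₁ , j , w₁ ++ w ++ γ)
    enabled-step i≤ (≢a , ≢r , t∈ , ≢◁ , _) eq γ =
      ≢a , ≢r , _ , _ , _ , _ , refl , t∈ , ≢◁⇒valid x i≤ ≢◁ eq , refl

    enabled≤ : ∀ {q i z q₁ m w₁ j} → i ≤ suc (length x) → Enabled q (tapeAt x i) z (q₁ , m , w₁) j →
      move i m ≡ just j →
      j ≤ suc (length x)
    enabled≤ i≤ (_ , _ , _ , ≢◁ , _) eq = proj₂ (≢◁⇒valid x i≤ ≢◁ eq)

    closed : ∀ {t c} → Valid atoms t → Holds Sem (derive t (tapeAt x (cell t)) c) → Sem t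
    closed {t} {c} _ h with derive t (tapeAt x (cell t)) c | derives t (tapeAt x (cell t)) c | h
    ... | _ | fact popped | fact = λ _ γ → ε
    ... | _ | fact accepted | fact = λ _ γ → _ , _ , ε
    ... | _ | one {w = w} en eq | one sem = λ i≤ γ →
      let j , γ′ , rs = sem (enabled≤ i≤ en eq) (w ++ γ) in j , γ′ , enabled-step {w = w} i≤ en eq γ ◅ rs
    ... | _ | two {w = w} {τ = just _} en eq _ | two sem₁ sem₂ = λ i≤ γ →
      let rs₁ = sem₁ (enabled≤ i≤ en eq) (w ++ γ)
      in enabled-step {w = w} i≤ en eq γ ◅ rs₁ ◅◅ sem₂ (on-tape rs₁ (enabled≤ i≤ en eq)) γ
    ... | _ | two {w = w} {τ = nothing} en eq _ | two sem₁ sem₂ = λ i≤ γ →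
      let rs₁ = sem₁ (enabled≤ i≤ en eq) (w ++ γ)
          j , γ′ , rs₂ = sem₂ (on-tape rs₁ (enabled≤ i≤ en eq)) γ
      in j , γ′ , enabled-step {w = w} i≤ en eq γ ◅ rs₁ ◅◅ rs₂

    settled : ∀ {n t} → Settled t → Derivation x n t
    settled {t = t} st = axiom {c = start , stay , [] , nothing}
      (state< start , moveCode-valid 3≤b stay , 0<b , no-exit-valid) is-fact
      where
      is-fact : derive t (tapeAt x (cell t)) _ ≡ fact
      is-fact with settled? t
      ... | yes _ = refl
      ... | no ¬st = ⊥-elim (¬st st)

    module _ (room : suc (length x) < b) where

      AcceptsAfter : ℕ → PConf M → Set
      AcceptsAfter k c = ∃ λ j → Σ Word λ γ → PStepsN M x k c (accept , j , γ)

      applied : ∀ {q i z w τ q₁ m w₁ j μ ρ} → ¬ Settled (q , i , z ∷ w , τ) →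
        ¬ q ≡ accept → ¬ q ≡ reject → (q₁ , m , w₁) ∈ δ q (tapeAt x i) z → ValidMove x i m j →
        follow q₁ j w₁ μ w τ ≡ ρ → derive (q , i , z ∷ w , τ) (tapeAt x i) (q₁ , m , w₁ , μ) ≡ ρ
      applied {q} {i} {z} {w} {τ} {q₁} {m} {w₁} {j} ¬st ≢a ≢r t∈ valid eq with settled? (q , i , z ∷ w , τ)
      ... | yes st = ⊥-elim (¬st st)
      ... | no _ rewrite proj₁ valid =
        trans (choose-yes (enabled? q (tapeAt x i) z (q₁ , m , w₁) j)
                (≢a , ≢r , t∈ , (λ m≡ → valid⇒≢◁ x valid m≡) , ≤-<-trans (proj₂ valid) room)) eq

      sequence : ∀ {q i z w τ q₁ m w₁ j q₂ i₂ k₁ k₂} → ¬ Settled (q , i , z ∷ w , τ) →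
        ¬ q ≡ accept → ¬ q ≡ reject → (q₁ , m , w₁) ∈ δ q (tapeAt x i) z → ValidMove x i m j → i₂ ≤ suc (length x) →
        Derivation x k₁ (q₁ , j , w₁ , just (q₂ , i₂)) → Derivation x k₂ (q₂ , i₂ , w , τ) →
        Derivation x (suc (k₁ + k₂)) (q , i , z ∷ w , τ)
      sequence {q₁ = q₁} {m} {w₁} {q₂ = q₂} {i₂} ¬st ≢a ≢r t∈ valid i₂≤ = binary {c = q₁ , m , w₁ , just (q₂ , i₂)}
        (state< q₁ , moveCode-valid 3≤b m , pushed-valid t∈ , exit-valid (≤-<-trans i₂≤ room))
        (applied ¬st ≢a ≢r t∈ valid (choose-yes (i₂ <? b) (≤-<-trans i₂≤ room)))

      -- A k-step accepting run from stack w ++ γ either accepts above γ or first pops w, after k₁ steps.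
      decompose : ∀ n {k q i} w γ → k ≤ n → i ≤ suc (length x) → AcceptsAfter k (q , i , w ++ γ) →
        Derivation x k (q , i , w , nothing) ⊎
        (∃ λ k₁ → ∃ λ k₂ → ∃ λ q₂ → ∃ λ i₂ → k₁ + k₂ ≡ k × ¬ q₂ ≡ accept × i₂ ≤ suc (length x) ×
          Derivation x k₁ (q , i , w , just (q₂ , i₂)) × AcceptsAfter k₂ (q₂ , i₂ , γ))
      decompose n {q = q} [] γ k≤ i≤ run with q ≟F accept
      ... | yes refl = inj₁ (settled accepted)
      ... | no ≢a = inj₂ (0 , _ , _ , _ , refl , ≢a , i≤ , settled popped , run)
      decompose n {zero} (z ∷ w) γ k≤ i≤ (_ , _ , refl) = inj₁ (settled accepted)
      decompose (suc n) {suc k} {q} {i} (z ∷ w) γ (s≤s k≤) i≤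
        (j′ , γ′ , (q₁ , j , _) , (≢a , ≢r , _ , _ , m , w₁ , refl , t∈ , valid , refl) , rest)
        with decompose n w₁ (w ++ γ) k≤ (proj₂ valid) (j′ , γ′ , rest)
      ... | inj₁ d = inj₁ (unary {c = q₁ , m , w₁ , nothing}
              (state< q₁ , moveCode-valid 3≤b m , pushed-valid t∈ , no-exit-valid)
              (applied {τ = nothing} {μ = nothing} (λ { accepted → ≢a refl }) ≢a ≢r t∈ valid refl) d)
      ... | inj₂ (k₁ , k₂ , q₂ , i₂ , refl , _ , i₂≤ , d₁ , rest₂)
        -- The remaining run is shorter but not a subterm of the given one; hence the fuel `n`.
        with decompose n w γ (≤-trans (m≤n+m k₂ k₁) k≤) i₂≤ rest₂
      ...   | inj₁ d₂ = inj₁ (sequence (λ { accepted → ≢a refl }) ≢a ≢r t∈ valid i₂≤ d₁ d₂)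
      ...   | inj₂ (l₁ , l₂ , q₃ , i₃ , refl , ≢a₃ , i₃≤ , d₂ , rest₃) =
        inj₂ (suc (k₁ + l₁) , l₂ , q₃ , i₃ , cong suc (+-assoc k₁ l₁ l₂) , ≢a₃ , i₃≤ ,
          sequence (λ ()) ≢a ≢r t∈ valid i₂≤ d₁ d₂ , rest₃)

      -- Each inference above the leaves consumes one step of the run, so the running time itself
      -- bounds the size. The budgeted circuit relies on this exact bound.
      acceptance : ∀ {k} → AcceptsAfter k (initP M) → Derivation x k initial
      acceptance {k} run with decompose k (bottom ∷ []) [] ≤-refl z≤n run
      ... | inj₁ d = d
      -- The other outcome is an empty stack outside `accept`: the run cannot end there, and the
      -- next line excludes a further step for want of a stack symbol.
      ... | inj₂ (_ , zero , _ , _ , _ , ≢a , _ , _ , _ , _ , refl) = ⊥-elim (≢a refl)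
      ... | inj₂ (_ , suc _ , _ , _ , _ , _ , _ , _ , _ , _ , _ , (_ , _ , _ , _ , _ , _ , () , _) , _)

-- Complement machines

module Complement {s} (C : Circuit s) (β : ℕ) .{{_ : NonZero β}}
  (target< : suc (Circuit.target C) < β) (slots< : Circuit.slots C < β) (4≤β : 4 ≤ β) where
  open Circuit C
  open Machine C β target< slots< 4≤β
  open Complementer C
  private module Compiled = Compile program β {{it}} {{it}}
  open Compiled
  open Compiled public using (pda)

  pda-rejects : ∀ x → suc (length x) < β → Truth.True C x target → ¬ PAccepts pda x
  pda-rejects x room t = pda-sound x room Inv step-inv start-inv (λ ¬t → ¬t t)
    where open Correctness x

  module _ (w : ℕ → ℕ) (W : ℕ)
    (w-bound : ∀ g → g ≤ target → w g ≤ W)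
    (w-pos : ∀ g → 0 < w g)
    (w-one : ∀ {g a r h} → rule g a r ≡ one h → w h < w g)
    (w-two : ∀ {g a r h k} → rule g a r ≡ two h k → w h + w k < w g) where

    time : ℕ → ℕ → ℕ
    time t u = t * gateTime + gateTime
      where
      gateTime : ℕ
      gateTime = suc W + (u * suc (t * suc W + 1) + 2)

    time-mono : ∀ {t t′ u u′} → t ≤ t′ → u ≤ u′ → time t u ≤ time t′ u′
    time-mono t≤ u≤ = +-mono-≤ (*-mono-≤ t≤ gate≤) gate≤
      where
      gate≤ = +-monoʳ-≤ (suc W) (+-monoˡ-≤ 2 (*-mono-≤ u≤ (s≤s (+-monoˡ-≤ 1 (*-monoˡ-≤ (suc W) t≤)))))

    pda-accepts : ∀ x → suc (length x) < β → ¬ Truth.True C x target →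
      ∃ λ j → Σ _ λ γ → Run (PStep pda x) (time β β * suc β + β) (initP pda) (TwoNPDA.accept pda , j , γ)
    pda-accepts x room ¬t =
      let γ , rs = pda-complete x room (complement-run ¬t)
      in 0 , γ , weaken (+-monoˡ-≤ β (*-monoˡ-≤ (suc β)
           (time-mono (≤-trans (n≤1+n _) (<⇒≤ target<)) (<⇒≤ slots<)))) rs
      where open Completeness w W w-bound w-pos w-one w-two x

  -- Only `prove-two` pushes a goal, and `pop` needs a symbol other than 0.
  Trans-constant : (∀ g a r {h k} → rule g a r ≢ two h k) → ∀ {a q q′ w} → Trans a q 0 q′ w → w ≡ 0 ∷ []
  Trans-constant linear (prove-two {r = r} _ eq) = ⊥-elim (linear _ _ r eq)
  Trans-constant linear guess-false = refl
  Trans-constant linear (guess-true _) = refl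
  Trans-constant linear (skip-rule _ _) = refl
  Trans-constant linear (pick _ _) = refl
  Trans-constant linear (next-gate _) = refl
  Trans-constant linear finish = refl
  Trans-constant linear (scan-skip _) = refl
  Trans-constant linear (scan-true _ _) = refl
  Trans-constant linear scan-done = refl
  Trans-constant linear (return _ _) = refl
  Trans-constant linear (prove-one _ _) = refl

  pda-constant : (∀ g a r {h k} → rule g a r ≢ two h k) → ∀ {q a q′ m w} →
    (q′ , m , w) ∈ TwoNPDA.δ pda q a (TwoNPDA.bottom pda) → w ≡ TwoNPDA.bottom pda ∷ []
  pda-constant linear {i} {a} t∈ = emitted (decode heads i) (toℕ-clamp (≤-trans (s≤s z≤n) 4≤β)) t∈
    where
    reacted : ∀ q h {q′ h′ m w} → (q′ , h′ , m , w) ∈ react q h a 0 → w ≡ 0 ∷ []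
    reacted q h t∈ with <-cmp h (cell q)
    reacted q h (here refl) | tri> _ _ _ = refl
    reacted q h t∈ | tri≈ _ _ _ with _ , u∈ , refl ← ∈-map⁻ _ t∈ = Trans-constant linear (next-sound {q} u∈)
    reacted q h t∈ | tri< _ _ _ with a ≟◁ | t∈
    ... | no _ | here refl = refl
    ... | yes _ | t∈ with _ , u∈ , refl ← ∈-map⁻ _ t∈ = Trans-constant linear (next-sound {q} u∈)

    emitted : ∀ k {z q′ m w} → z ≡ 0 → (q′ , m , w) ∈ map emit (react (proj₁ k) (proj₂ k) a z) → w ≡ symbol 0 ∷ []
    emitted (q , h) refl t∈ with _ , u∈ , refl ← ∈-map⁻ emit t∈ = cong (map symbol) (reacted q h u∈)

-- Polynomial bounds on size and time

v : Poly 1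
v = var Fin.zero

-- The time bound with `W = β`: a program step costs at most `suc β` automaton steps, and the final
-- β steps bring the head back to ▷.
timePoly : Poly 1
timePoly = (((v ⊗ gateTime) ⊕ gateTime) ⊗ (con 1 ⊕ v)) ⊕ v
  where
  gateTime : Poly 1
  gateTime = (con 1 ⊕ v) ⊕ ((v ⊗ (con 1 ⊕ ((v ⊗ (con 1 ⊕ v)) ⊕ con 1))) ⊕ con 2)

-- Nine digits for a program state and one for the head position, associated as in the codes, so
-- that the size bounds hold by computation.
statePoly : Poly 1
statePoly = (v ⊗ (v ⊗ (v ⊗ (v ⊗ (v ⊗ (v ⊗ (v ⊗ (v ⊗ v)))))))) ⊗ v

wordPoly : Poly 1
wordPoly = (con 1 ⊕ (v ⊗ con 1)) ⊕ (v ⊗ (v ⊗ con 1))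

-- What the parameter β of the constructions below has to exceed, in terms of the size b of the given machine.
largePoly : Poly 1 → Poly 1 → Poly 1 → Poly 1
largePoly J A slots = ((con 1 ⊕ J) ⊗ A) ⊕ (slots ⊕ (con 4 ⊕ (v ⊕ (v ⊕ v))))

module Bounds {J A slots b β : ℕ} (large : suc J * A + (slots + (4 + (b + (b + b)))) ≤ β) where

  gate<β : ∀ {k} → k < A → suc (k + J * A) < β
  gate<β k< = <-≤-trans (s≤s (+-monoˡ-≤ (J * A) k<))
    (≤-trans (≤-trans (≤-reflexive (+-comm 1 _)) (+-monoʳ-≤ (suc J * A) (≤-trans (s≤s z≤n) (m≤n+m _ slots)))) large)

  slots<β : slots < β
  slots<β = ≤-trans (≤-trans (≤-reflexive (+-comm 1 slots)) (+-monoʳ-≤ slots (s≤s z≤n)))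
    (≤-trans (m≤n+m _ (suc J * A)) large)

  4+3b≤β : 4 + (b + (b + b)) ≤ β
  4+3b≤β = ≤-trans (m≤n+m _ slots) (≤-trans (m≤n+m _ (suc J * A)) large)

  4≤β : 4 ≤ β
  4≤β = ≤-trans (m≤m+n 4 _) 4+3b≤β

  b≤β : b ≤ β
  b≤β = ≤-trans (≤-trans (m≤m+n b (b + b)) (m≤n+m _ 4)) 4+3b≤β

  -- `suc (b + b)` is the weight of a gate of level `b` in the budgeted circuit.
  2b+1≤β : suc (b + b) ≤ β
  2b+1≤β = ≤-trans (s≤s (≤-trans (m≤n+m (b + b) b) (m≤n+m _ 3))) 4+3b≤β

module DepthComplement {s} (S : System s) .{{_ : NonZero (bound (System.atoms S))}}
  .{{_ : NonZero (bound (System.choices S ×ᶜ trivial))}}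
  (initial : System.Atom S) (initial-valid : Valid (System.atoms S) initial) (b β : ℕ)
  (large : suc (bound (System.atoms S)) * bound (System.atoms S) +
    (bound (System.choices S ×ᶜ trivial) + (4 + (b + (b + b)))) ≤ β) where
  open System S

  open Bounds {bound atoms} {bound atoms} {bound (choices ×ᶜ trivial)} {b} large public
  -- The goal is the gate of `initial` at level `bound atoms`, where truth has stabilised.
  open Depth S (toℕ (code atoms initial) + bound atoms * bound atoms)

  private instance
    β≢0 : NonZero β
    β≢0 = >-nonZero (≤-trans (s≤s z≤n) 4≤β)

  open Complement circuit β (gate<β (index< initial)) slots<β 4≤β public

  module _ (x : Str s) (room : suc (length x) < β) where

    rejects : ∀ {k} → Derivation x k initial → ¬ PAccepts pda x
    rejects d = pda-rejects x room (derivable x {t = initial} initial-valid d)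

    accepts : (Sem : Atom → Set)
      (closed : ∀ {t c} → Valid atoms t → Holds Sem (derive t (tapeAt x (cell t)) c) → Sem t) →
      ¬ Sem initial → PAccepts pda x
    accepts Sem closed ¬sem =
      let j , γ , rs = pda-accepts weight (ω (level _)) weight-bound weight-pos
                         (λ {g} {a} {r} → weight-one {g} {a} {r}) (λ {g} {a} {r} → weight-two {g} {a} {r}) x room
                         λ t → ¬sem (premise-sound (bound atoms) {initial} initial-valid t)
      in j , γ , run⇒star rs
      where open Sound x Sem (λ {t} {c} → closed {t} {c})

  constant : (∀ t a c {u v} → derive t a c ≢ two u v) → ∀ {q a q′ m w} →
    (q′ , m , w) ∈ TwoNPDA.δ pda q a (TwoNPDA.bottom pda) → w ≡ TwoNPDA.bottom pda ∷ []
  constant linear {i} {a} = pda-constant (λ g a r → unforked (level g) _ (linear (atomOf g) a (proj₁ (slot r)))) {i} {a}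
    where
    unforked : ∀ j ρ {h k} → (∀ {t u} → ρ ≢ two t u) → lift j tt ρ ≢ two h k
    unforked j none ≢ ()
    unforked j fact ≢ ()
    unforked zero (one _) ≢ ()
    unforked (suc j) (one _) ≢ ()
    unforked j (two _ _) ≢ _ = ≢ refl

module BudgetComplement {s} (S : System s) (b : ℕ) .{{_ : NonZero b}} .{{_ : NonZero (bound (System.atoms S))}}
  .{{_ : NonZero (bound (System.choices S ×ᶜ belowCode b))}}
  (initial : System.Atom S) (initial-valid : Valid (System.atoms S) initial) (β : ℕ)
  (large : suc b * bound (System.atoms S) +
    (bound (System.choices S ×ᶜ belowCode b) + (4 + (b + (b + b)))) ≤ β) where
  open System S

  open Bounds {b} {bound atoms} {bound (choices ×ᶜ belowCode b)} {b} large public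
  -- The minimum keeps the first share within `j` for every guessed `m`; the two shares add up to
  -- exactly `j`.
  open Levelled S (belowCode b) (λ j m → m ⊓ j , j ∸ m) (λ j m → m⊓n≤n m j , m∸n≤m j m)
    (toℕ (code atoms initial) + b * bound atoms)

  private instance
    β≢0 : NonZero β
    β≢0 = >-nonZero (≤-trans (s≤s z≤n) 4≤β)

  open Complement circuit β (gate<β (index< initial)) slots<β 4≤β public

  -- A tree with at most `j` inner nodes, each of at most two children, has at most `2j+1` nodes.
  -- The inequality of `ω-split` is tight.
  ω : ℕ → ℕ
  ω j = suc (j + j)

  ω-split : ∀ j m → ω (m ⊓ j) + ω (j ∸ m) < ω (suc j)
  ω-split j m = ≤-reflexive (trans (regroup (m ⊓ j) (j ∸ m)) (cong (λ k → ω (suc k)) (m⊓n+n∸m≡n m j)))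
    where
    regroup : ∀ p q → suc (ω p + ω q) ≡ ω (suc (p + q))
    regroup p q = cong (λ (k : ℕ) → suc (suc k)) (trans (+-suc (p + p) (q + q))
      (trans (cong suc (interchange p q)) (≡-sym (+-suc (p + q) (p + q)))))
      where
      interchange : ∀ p q → p + p + (q + q) ≡ p + q + (p + q)
      interchange = solve-∀

  open Weights ω (λ j → s≤s (s≤s (+-monoʳ-≤ j (n≤1+n j)))) ω-split (s≤s z≤n)

  goal-weight : ∀ g → g ≤ Circuit.target circuit → weight g ≤ β
  goal-weight g g≤ = ≤-trans (weight-bound g g≤)
    (subst (λ j → ω j ≤ β) (≡-sym (level-gate b (index< initial))) 2b+1≤β)

  private module Clocked = Clock pda (eval₁ timePoly β)
  open Clocked
  open Clocked public using (clocked; clocked-halts)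

  module _ (x : Str s) (room : suc (length x) < β) where

    covers : ∀ {i} → i < b → Covers x i
    covers i< {m} {n} m+n≤i = m , ≤-<-trans m≤i i< , ⊓-glb ≤-refl m≤i ,
      subst (_≤ _) (m+n∸m≡n m n) (∸-monoˡ-≤ m m+n≤i)
      where
      m≤i = ≤-trans (m≤m+n m n) m+n≤i

    rejects : ∀ {k} → k ≤ b → Derivation x k initial → ¬ PAccepts clocked x
    rejects k≤b d acc = pda-rejects x room
      (complete x {t = initial} b (0 , >-nonZero⁻¹ b) covers k≤b initial-valid d) (clocked-sound x acc)

    accepts : (Sem : Atom → Set)
      (closed : ∀ {t c} → Valid atoms t → Holds Sem (derive t (tapeAt x (cell t)) c) → Sem t) →
      ¬ Sem initial → PAccepts clocked x
    accepts Sem closed ¬sem =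
      let j , γ , rs = pda-accepts weight β goal-weight weight-pos
                         (λ {g} {a} {r} → weight-one {g} {a} {r}) (λ {g} {a} {r} → weight-two {g} {a} {r}) x room
                         λ t → ¬sem (premise-sound b {initial} initial-valid t)
      in clocked-accepts x ≤-refl rs
      where open Sound x Sem (λ {t} {c} → closed {t} {c})

-- One factor each for state, head and word, and three for the tag, state and head of the exit. In a
-- choice a move replaces the head, so the bound is the same.
atomPoly : Poly 1
atomPoly = v ⊗ (v ⊗ (v ⊗ (v ⊗ (v ⊗ v))))

atomPoly≢0 : ∀ b .{{_ : NonZero b}} → NonZero (eval₁ atomPoly b)
atomPoly≢0 b = m*n≢0 b _ {{it}} {{m*n≢0 b _ {{it}} {{m*n≢0 b _ {{it}} {{m*n≢0 b _ {{it}} {{m*n≢0 b b}}}}}}}}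

star⇒stepsN : ∀ {s} (M : TwoNPDA s) x {c c′} → Star (PStep M x) c c′ → ∃ λ k → PStepsN M x k c c′
star⇒stepsN M x ε = 0 , refl
star⇒stepsN M x (r ◅ rs) = let k , rs′ = star⇒stepsN M x rs in suc k , _ , r , rs′

pdaPoly : Poly 1
pdaPoly = statePoly ⊗ wordPoly

clockedPoly : Poly 1
clockedPoly = (statePoly ⊗ (con 1 ⊕ timePoly)) ⊗ wordPoly

wordsUpTo≢0 : ∀ g e → NonZero (wordsUpTo g e)
wordsUpTo≢0 g e = >-nonZero (wordsUpTo-mono g {0} {e} z≤n)

states≤size : ∀ {s} (M : TwoNPDA s) → TwoNPDA.nstates M ≤ pdaSize M
states≤size M = m≤m*n (nstates) (wordsUpTo nstack e) {{wordsUpTo≢0 nstack e}}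
  where open TwoNPDA M

words≤size : ∀ {s} (M : TwoNPDA s) → wordsUpTo (TwoNPDA.nstack M) (TwoNPDA.e M) ≤ pdaSize M
words≤size M = m≤n*m (wordsUpTo nstack e) nstates {{Fin⇒NonZero start}}
  where open TwoNPDA M

stepsN-prefix : ∀ {s} (M : TwoNPDA s) x m {n c c′} → PStepsN M x (m + n) c c′ → ∃ λ c″ → PStepsN M x m c c″
stepsN-prefix M x zero sts = _ , refl
stepsN-prefix M x (suc m) (d , st , sts) = let e , sts′ = stepsN-prefix M x m sts in e , d , st , sts′

halts⇒steps≤ : ∀ {s} (M : TwoNPDA s) x {t k c} → PHaltsWithin M x t → PStepsN M x k (initP M) c → k ≤ t
halts⇒steps≤ M x {t} {k} halts sts = ≮⇒≥ λ t<k →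
  let c′ , sts′ = stepsN-prefix M x (suc t) (subst (λ k → PStepsN M x k _ _) (≡-sym (m+[n∸m]≡n t<k)) sts)
  in halts c′ sts′

-- The three complement constructions for a single machine

module NFAComplement {s} (M : TwoNFA s) (b : ℕ) .{{_ : NonZero b}} (states≤ : TwoNFA.nstates M ≤ b) (3≤b : 3 ≤ b)
  (β : ℕ) (large : eval₁ (largePoly (v ⊗ v) (v ⊗ v) ((v ⊗ v) ⊗ con 1)) b ≤ β) where
  open NFASystem M b states≤ 3≤b

  private
    instance
      b²≢0 : NonZero (b * b)
      b²≢0 = m*n≢0 b b
      b²*1≢0 : NonZero (b * b * 1)
      b²*1≢0 = m*n≢0 (b * b) 1

    module Co = DepthComplement system initial initial-valid b β large

  open Stackless Co.pda (λ {q} {a} → Co.constant linear {q} {a}) public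

  size : nfaSize nfa ≤ eval₁ statePoly β
  size = ≤-refl

  module _ (x : Str s) (room : suc (length x) < b) where

    rejects : NAccepts M x → ¬ NAccepts nfa x
    rejects (j , rs) acc =
      Co.rejects x (<-≤-trans room Co.b≤β) (derivation x room (proj₂ (star⇒run rs))) (nfa-sound x acc)

    accepts : ¬ NAccepts M x → NAccepts nfa x
    accepts ¬acc = nfa-complete x (Co.accepts x (<-≤-trans room Co.b≤β) (Sem x) (λ {t} {c} → closed x {t} {c})
      (λ sem → ¬acc (sem z≤n)))

module PDAComplement {s} (M : TwoNPDA s) (b : ℕ) .{{_ : NonZero b}} (states≤ : TwoNPDA.nstates M ≤ b)
  (words≤ : wordsUpTo (TwoNPDA.nstack M) (TwoNPDA.e M) ≤ b) (3≤b : 3 ≤ b)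
  (β : ℕ) (large : eval₁ (largePoly atomPoly atomPoly (atomPoly ⊗ con 1)) b ≤ β) where
  open PDASystem M b states≤ words≤ 3≤b

  private
    instance
      A≢0 : NonZero (eval₁ atomPoly b)
      A≢0 = atomPoly≢0 b
      A*1≢0 : NonZero (eval₁ atomPoly b * 1)
      A*1≢0 = m*n≢0 (eval₁ atomPoly b) 1

    module Co = DepthComplement system initial initial-valid b β large
  open Co public using (pda)

  size : pdaSize pda ≤ eval₁ pdaPoly β
  size = ≤-refl

  module _ (x : Str s) (room : suc (length x) < b) where

    rejects : PAccepts M x → ¬ PAccepts pda x
    rejects (j , γ , rs) =
      Co.rejects x (<-≤-trans room Co.b≤β) (acceptance x room (j , γ , proj₂ (star⇒stepsN M x rs)))

    accepts : ¬ PAccepts M x → PAccepts pda x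
    accepts ¬acc = Co.accepts x (<-≤-trans room Co.b≤β) (Sem x) (λ {t} {c} → closed x {t} {c})
      (λ sem → ¬acc (sem z≤n []))

module TimedComplement {s} (M : TwoNPDA s) (b : ℕ) .{{_ : NonZero b}} (states≤ : TwoNPDA.nstates M ≤ b)
  (words≤ : wordsUpTo (TwoNPDA.nstack M) (TwoNPDA.e M) ≤ b) (3≤b : 3 ≤ b)
  (β : ℕ) (large : eval₁ (largePoly v atomPoly (atomPoly ⊗ v)) b ≤ β) where
  open PDASystem M b states≤ words≤ 3≤b

  private
    instance
      A≢0 : NonZero (eval₁ atomPoly b)
      A≢0 = atomPoly≢0 b
      A*b≢0 : NonZero (eval₁ atomPoly b * b)
      A*b≢0 = m*n≢0 (eval₁ atomPoly b) b

    module Co = BudgetComplement system b initial initial-valid β large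
  open Co public using (clocked; clocked-halts)

  size : pdaSize clocked ≤ eval₁ clockedPoly β
  size = ≤-refl

  module _ (x : Str s) (room : suc (length x) < b) where

    rejects : ∀ {k j γ} → k ≤ b → PStepsN M x k (initP M) (TwoNPDA.accept M , j , γ) → ¬ PAccepts clocked x
    rejects k≤b rs = Co.rejects x (<-≤-trans room Co.b≤β) k≤b (acceptance x room (_ , _ , rs))

    accepts : ¬ PAccepts M x → PAccepts clocked x
    accepts ¬acc = Co.accepts x (<-≤-trans room Co.b≤β) (Sem x) (λ {t} {c} → closed x {t} {c})
      (λ sem → ¬acc (sem z≤n []))

-- Two implications suffice: a promised input comes with acceptance or with its refutation, so
-- acceptance by `M` is never decided.
Complements-NFA : ∀ {s} → TwoNFA s → TwoNFA s → Str s → Set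
Complements-NFA M N x = (NAccepts M x → ¬ NAccepts N x) × (¬ NAccepts M x → NAccepts N x)

Complements-PDA : ∀ {s} → TwoNPDA s → TwoNPDA s → Str s → Set
Complements-PDA M N x = (PAccepts M x → ¬ PAccepts N x) × (¬ PAccepts M x → PAccepts N x)

nfaβᵖ pdaβᵖ clockedβᵖ : Poly 1
nfaβᵖ = largePoly (v ⊗ v) (v ⊗ v) ((v ⊗ v) ⊗ con 1)
pdaβᵖ = largePoly atomPoly atomPoly (atomPoly ⊗ con 1)
clockedβᵖ = largePoly v atomPoly (atomPoly ⊗ v)

NFAComplementOf : ∀ {s} → TwoNFA s → (b β : ℕ) → Set
NFAComplementOf {s} M b β = Σ (TwoNFA s) λ N →
  nfaSize N ≤ eval₁ statePoly β × (∀ x → suc (length x) < b → Complements-NFA M N x)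

PDAComplementOf : ∀ {s} → TwoNPDA s → (b β : ℕ) → Set
PDAComplementOf {s} M b β = Σ (TwoNPDA s) λ N →
  pdaSize N ≤ eval₁ pdaPoly β × (∀ x → suc (length x) < b → Complements-PDA M N x)

ClockedComplementOf : ∀ {s} → TwoNPDA s → (b β : ℕ) → Set
ClockedComplementOf {s} M b β = Σ (TwoNPDA s) λ N →
  pdaSize N ≤ eval₁ clockedPoly β × (∀ x → PHaltsWithin N x (eval₁ timePoly β)) ×
  (∀ x → suc (length x) < b → PHaltsWithin M x b → Complements-PDA M N x)

complement-nfa : ∀ {s} (M : TwoNFA s) b β → nfaSize M ≤ b → 3 ≤ b → eval₁ nfaβᵖ b ≤ β → NFAComplementOf M b β
complement-nfa M b β size≤ 3≤b large = nfa , size , λ x room → rejects x room , accepts x room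
  where open NFAComplement M b {{>-nonZero (≤-trans (s≤s z≤n) 3≤b)}} size≤ 3≤b β large

complement-pda : ∀ {s} (M : TwoNPDA s) b β → pdaSize M ≤ b → 3 ≤ b → eval₁ pdaβᵖ b ≤ β → PDAComplementOf M b β
complement-pda M b β size≤ 3≤b large = pda , size , λ x room → rejects x room , accepts x room
  where open PDAComplement M b {{>-nonZero (≤-trans (s≤s z≤n) 3≤b)}}
          (≤-trans (states≤size M) size≤) (≤-trans (words≤size M) size≤) 3≤b β large

complement-clocked : ∀ {s} (M : TwoNPDA s) b β → pdaSize M ≤ b → 3 ≤ b → eval₁ clockedβᵖ b ≤ β →
  ClockedComplementOf M b β
complement-clocked M b β size≤ 3≤b large = clocked , size , clocked-halts , λ x room halts →
    (λ (_ , _ , rs) → let _ , rs′ = star⇒stepsN M x rs in rejects x room (halts⇒steps≤ M x halts rs′) rs′) ,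
    accepts x room
  where open TimedComplement M b {{>-nonZero (≤-trans (s≤s z≤n) 3≤b)}}
          (≤-trans (states≤size M) size≤) (≤-trans (words≤size M) size≤) 3≤b β large

-- Polynomials and families

substitute : ∀ {k l} → (Fin k → Poly l) → Poly k → Poly l
substitute σ (var i) = σ i
substitute σ (con c) = con c
substitute σ (p ⊕ q) = substitute σ p ⊕ substitute σ q
substitute σ (p ⊗ q) = substitute σ p ⊗ substitute σ q

substitute-eval : ∀ {k l} (σ : Fin k → Poly l) p {ρ} → ⟦ substitute σ p ⟧ ρ ≡ ⟦ p ⟧ (λ i → ⟦ σ i ⟧ ρ)
substitute-eval σ (var i) = refl
substitute-eval σ (con c) = refl
substitute-eval σ (p ⊕ q) = cong₂ _+_ (substitute-eval σ p) (substitute-eval σ q)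
substitute-eval σ (p ⊗ q) = cong₂ _*_ (substitute-eval σ p) (substitute-eval σ q)

eval-mono : ∀ {k} (p : Poly k) {ρ ρ′} → (∀ i → ρ i ≤ ρ′ i) → ⟦ p ⟧ ρ ≤ ⟦ p ⟧ ρ′
eval-mono (var i) ρ≤ = ρ≤ i
eval-mono (con c) ρ≤ = ≤-refl
eval-mono (p ⊕ q) ρ≤ = +-mono-≤ (eval-mono p ρ≤) (eval-mono q ρ≤)
eval-mono (p ⊗ q) ρ≤ = *-mono-≤ (eval-mono p ρ≤) (eval-mono q ρ≤)

infixr 9 _∘ᵖ_
_∘ᵖ_ : ∀ {k} → Poly 1 → Poly k → Poly k
p ∘ᵖ q = substitute (λ _ → q) p

∘ᵖ-eval : ∀ p q n → eval₁ (p ∘ᵖ q) n ≡ eval₁ p (eval₁ q n)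
∘ᵖ-eval p q n = substitute-eval (λ _ → q) p

swap-ceiling : ∀ {s} {L : Family s} → HasPolyCeiling L → HasPolyCeiling (λ n → swapPP (L n))
swap-ceiling (c , bounded) = c , λ { n x (inj₁ r) → bounded n x (inj₂ r) ; n x (inj₂ a) → bounded n x (inj₁ a) }

halts-mono : ∀ {s} (M : TwoNPDA s) x {t u} → t ≤ u → PHaltsWithin M x t → PHaltsWithin M x u
halts-mono M x {t} {u} t≤u halts c sts = <-irrefl refl (≤-trans (halts⇒steps≤ M x halts sts) t≤u)

module _ {s} (L : Family s) where
  open PromiseProblem

  swapped : Family s
  swapped n = swapPP (L n)

  Promised : ℕ → Str s → Set
  Promised n x = Acc (L n) x ⊎ Rej (L n) x

  bounded⇒room : (p c q : Poly 1) → (∀ n x → Promised n x → length x ≤ eval₁ c n) →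
    ∀ n x → Promised n x → suc (length x) < eval₁ (con 3 ⊕ (p ⊕ (c ⊕ q))) n
  bounded⇒room p c q bounded n x x∈ = s≤s (s≤s (≤-trans (bounded n x x∈)
    (≤-trans (m≤m+n _ (eval₁ q n)) (≤-trans (m≤n+m _ (eval₁ p n)) (n≤1+n _)))))

  module Assemble2N (M : ℕ → TwoNFA s) (solves : ∀ n → NSolves (M n) (L n)) (bᵖ βᵖ : Poly 1)
    (room : ∀ n x → Promised n x → suc (length x) < eval₁ bᵖ n)
    (machine : ∀ n → NFAComplementOf (M n) (eval₁ bᵖ n) (eval₁ βᵖ n)) where

    assembled : 2N swapped
    assembled = statePoly ∘ᵖ βᵖ , (λ n → proj₁ (machine n)) , λ n →
      ≤-trans (proj₁ (proj₂ (machine n))) (≤-reflexive (≡-sym (∘ᵖ-eval statePoly βᵖ n))) ,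
      (λ x r → proj₂ (proj₂ (proj₂ (machine n)) x (room n x (inj₂ r))) (proj₂ (solves n) x r)) ,
      (λ x a → proj₁ (proj₂ (proj₂ (machine n)) x (room n x (inj₁ a))) (proj₁ (solves n) x a))

  module Assemble2NPD (M : ℕ → TwoNPDA s) (solves : ∀ n → PSolves (M n) (L n)) (bᵖ βᵖ : Poly 1)
    (room : ∀ n x → Promised n x → suc (length x) < eval₁ bᵖ n)
    (machine : ∀ n → PDAComplementOf (M n) (eval₁ bᵖ n) (eval₁ βᵖ n)) where

    assembled : 2NPD swapped
    assembled = pdaPoly ∘ᵖ βᵖ , (λ n → proj₁ (machine n)) , λ n →
      ≤-trans (proj₁ (proj₂ (machine n))) (≤-reflexive (≡-sym (∘ᵖ-eval pdaPoly βᵖ n))) ,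
      (λ x r → proj₂ (proj₂ (proj₂ (machine n)) x (room n x (inj₂ r))) (proj₂ (solves n) x r)) ,
      (λ x a → proj₁ (proj₂ (proj₂ (machine n)) x (room n x (inj₁ a))) (proj₁ (solves n) x a))

  module AssemblePolytime (M : ℕ → TwoNPDA s) (solves : ∀ n → PSolves (M n) (L n)) (bᵖ βᵖ : Poly 1)
    (room : ∀ n x → Promised n x → suc (length x) < eval₁ bᵖ n)
    (halts : ∀ n x → Promised n x → PHaltsWithin (M n) x (eval₁ bᵖ n))
    (machine : ∀ n → ClockedComplementOf (M n) (eval₁ bᵖ n) (eval₁ βᵖ n)) where

    complements : ∀ n x → Promised n x → Complements-PDA (M n) (proj₁ (machine n)) x
    complements n x x∈ = proj₂ (proj₂ (proj₂ (machine n))) x (room n x x∈) (halts n x x∈)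

    time≡ : ∀ n l → eval₂ (timePoly ∘ᵖ (βᵖ ∘ᵖ var Fin.zero)) n l ≡ eval₁ timePoly (eval₁ βᵖ n)
    time≡ n l = trans (substitute-eval (λ _ → βᵖ ∘ᵖ var Fin.zero) timePoly)
      (cong (eval₁ timePoly) (substitute-eval (λ _ → var Fin.zero) βᵖ))

    assembled : 2NPD-polytime swapped
    assembled = clockedPoly ∘ᵖ βᵖ , timePoly ∘ᵖ (βᵖ ∘ᵖ var Fin.zero) , (λ n → proj₁ (machine n)) , λ n →
      ≤-trans (proj₁ (proj₂ (machine n))) (≤-reflexive (≡-sym (∘ᵖ-eval clockedPoly βᵖ n))) ,
      ((λ x r → proj₂ (complements n x (inj₂ r)) (proj₂ (solves n) x r)) ,
       (λ x a → proj₁ (complements n x (inj₁ a)) (proj₁ (solves n) x a))) ,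
      (λ x _ → subst (PHaltsWithin (proj₁ (machine n)) x) (≡-sym (time≡ n (length x)))
                 (proj₁ (proj₂ (proj₂ (machine n))) x))

  2N-complement : (2N /poly) L → (2N /poly) swapped
  2N-complement ((p , M , solves) , c , bounded) =
    Assemble2N.assembled M (λ n → proj₂ (solves n)) bᵖ βᵖ (bounded⇒room p c (con 0) bounded) machine ,
    swap-ceiling {L = L} (c , bounded)
    where
    bᵖ βᵖ : Poly 1
    -- The 3 provides codes for the three moves and covers the two endmarkers in the room for head
    -- positions.
    bᵖ = con 3 ⊕ (p ⊕ (c ⊕ con 0))
    βᵖ = nfaβᵖ ∘ᵖ bᵖ

    machine : ∀ n → NFAComplementOf (M n) (eval₁ bᵖ n) (eval₁ βᵖ n)
    machine n = complement-nfa (M n) (eval₁ bᵖ n) (eval₁ βᵖ n)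
      (≤-trans (proj₁ (solves n)) (≤-trans (m≤m+n _ _) (m≤n+m _ 3)))
      (m≤m+n 3 _) (≤-reflexive (≡-sym (∘ᵖ-eval nfaβᵖ bᵖ n)))

  2NPD-complement : (2NPD /poly) L → (2NPD /poly) swapped
  2NPD-complement ((p , M , solves) , c , bounded) =
    Assemble2NPD.assembled M (λ n → proj₂ (solves n)) bᵖ βᵖ (bounded⇒room p c (con 0) bounded) machine ,
    swap-ceiling {L = L} (c , bounded)
    where
    bᵖ βᵖ : Poly 1
    bᵖ = con 3 ⊕ (p ⊕ (c ⊕ con 0))
    βᵖ = pdaβᵖ ∘ᵖ bᵖ

    machine : ∀ n → PDAComplementOf (M n) (eval₁ bᵖ n) (eval₁ βᵖ n)
    machine n = complement-pda (M n) (eval₁ bᵖ n) (eval₁ βᵖ n)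
      (≤-trans (proj₁ (solves n)) (≤-trans (m≤m+n _ _) (m≤n+m _ 3)))
      (m≤m+n 3 _) (≤-reflexive (≡-sym (∘ᵖ-eval pdaβᵖ bᵖ n)))

  2NPD-polytime-complement : (2NPD-polytime /poly) L → (2NPD-polytime /poly) swapped
  2NPD-polytime-complement ((p , t , M , solves) , c , bounded) =
    AssemblePolytime.assembled M (λ n → proj₁ (proj₂ (solves n))) bᵖ βᵖ (bounded⇒room p c tᵖ bounded)
      (λ n x x∈ → halts-mono (M n) x (time≤b n x x∈) (proj₂ (proj₂ (solves n)) x x∈)) machine ,
    swap-ceiling {L = L} (c , bounded)
    where
    -- On promised inputs the ceiling replaces the length, so the budget depends on n alone.
    arguments : Fin 2 → Poly 1
    arguments Fin.zero = var Fin.zero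
    arguments (Fin.suc _) = c

    tᵖ bᵖ βᵖ : Poly 1
    tᵖ = substitute arguments t
    bᵖ = con 3 ⊕ (p ⊕ (c ⊕ tᵖ))
    βᵖ = clockedβᵖ ∘ᵖ bᵖ

    machine : ∀ n → ClockedComplementOf (M n) (eval₁ bᵖ n) (eval₁ βᵖ n)
    machine n = complement-clocked (M n) (eval₁ bᵖ n) (eval₁ βᵖ n)
      (≤-trans (proj₁ (solves n)) (≤-trans (m≤m+n _ _) (m≤n+m _ 3)))
      (m≤m+n 3 _) (≤-reflexive (≡-sym (∘ᵖ-eval clockedβᵖ bᵖ n)))

    time≤b : ∀ n x → Promised n x → eval₂ t n (length x) ≤ eval₁ bᵖ n
    time≤b n x x∈ = ≤-trans (eval-mono t λ { Fin.zero → ≤-refl ; (Fin.suc _) → bounded n x x∈ })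
      (≤-trans (≤-reflexive (≡-sym (substitute-eval arguments t)))
        (≤-trans (m≤n+m _ (eval₁ c n)) (≤-trans (m≤n+m _ (eval₁ p n)) (m≤n+m _ 3))))

theorem5p4 : ((s : ℕ) (L : Family s) → ((2N /poly) L → co (2N /poly) L) × (co (2N /poly) L → (2N /poly) L))
    × ((s : ℕ) (L : Family s) → ((2NPD /poly) L → co (2NPD /poly) L) × (co (2NPD /poly) L → (2NPD /poly) L))
    × ((s : ℕ) (L : Family s) → ((2NPD-polytime /poly) L → co (2NPD-polytime /poly) L) × (co (2NPD-polytime /poly) L → (2NPD-polytime /poly) L))
theorem5p4 =
    -- Swapping twice gives back `L` definitionally, by eta for records, so the converse is the same
    -- lemma at `swapped L`.
    (λ s L → 2N-complement L , 2N-complement (swapped L))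
  , (λ s L → 2NPD-complement L , 2NPD-complement (swapped L))
  , (λ s L → 2NPD-polytime-complement L , 2NPD-polytime-complement (swapped L))
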